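{- Let $p$ be an odd prime with $p - 1 = 2 q_1 \cdots q_k$ for some $k \ge 0$ and distinct odd primes $q_1, \dots, q_k$, and let $n = 2p$. Then the number of exponential orthomorphisms modulo $n$ is at least \[ \frac{(k+2)! \cdot 3^{k+1} \cdot 2^{n-2^{k-1}}}{4(n-2)^{3 \cdot 2^{k-1}}}. \]
   Context: For an integer $n \ge 2$, an exponential orthomorphism modulo $n$ is a permutation $\sigma$ of $\{1, \dots, n-1\}$ such that the map $x \mapsto x^{\sigma(x)} \bmod n$ is also a bijection of $\{1, \dots, n-1\}$ (residues taken in $\{0,\dots,n-1\}$). -}

module Defs where

open import Data.Bool using (Bool; true; false; _∧_; _∨_; not)
open import Data.Nat using (ℕ; zero; suc; _∸_; _^_; _%_; _≡ᵇ_; _<ᵇ_)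
open import Data.List using (List; []; _∷_; map; upTo; concatMap; length; filterᵇ)
open import Data.Bool.ListAction using (all; any)

range : ℕ → List ℕ
range n = map suc (upTo (n ∸ 1))

inRange : ℕ → ℕ → Bool
inRange n y = (0 <ᵇ y) ∧ (y <ᵇ n)

isBijOn : ℕ → (ℕ → ℕ) → Bool
isBijOn n f =
  all (λ x → inRange n (f x)) (range n)
  ∧ all (λ x → all (λ y → not (f x ≡ᵇ f y) ∨ (x ≡ᵇ y)) (range n)) (range n)
  ∧ all (λ y → any (λ x → f x ≡ᵇ y) (range n)) (range n)

allLists : ℕ → List ℕ → List (List ℕ)
allLists zero    xs = [] ∷ []
allLists (suc m) xs = concatMap (λ x → map (x ∷_) (allLists m xs)) xs

nth : List ℕ → ℕ → ℕ
nth []       _       = 0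
nth (a ∷ l)  zero    = a
nth (a ∷ l)  (suc i) = nth l i

-- a list l = [σ(1), ..., σ(n-1)] read as a function on {1,...,n-1}
asFun : List ℕ → ℕ → ℕ
asFun l x = nth l (x ∸ 1)

-- x mod n (only used for n ≥ 2; the n = 0 case is an arbitrary convention)
modN : ℕ → ℕ → ℕ
modN x zero    = x
modN x (suc m) = x % suc m

isExpOrth : ℕ → (ℕ → ℕ) → Bool
isExpOrth n σ = isBijOn n σ ∧ isBijOn n (λ x → modN (x ^ σ x) n)

-- number of exponential orthomorphisms modulo n (n ≥ 2), counting over all
-- maps {1..n-1} → {1..n-1}, each given by its value list [σ(1),...,σ(n-1)]
numExpOrth : ℕ → ℕ
numExpOrth n = length (filterᵇ (λ l → isExpOrth n (asFun l)) (allLists (n ∸ 1) (range n)))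

{-# OPTIONS --safe #-}
-- Let m = p - 1.  The nonzero residues modulo 2p other than p form two copies (odd and even) of the
-- group 𝔽_p^×, which is cyclic of order m, and the exponents 1, …, 2m form two copies of ℤ/m; the
-- remaining exponent 2m + 1 is given to p.  So it suffices to count the bijections s of two copies of
-- ℤ/m for which j ↦ j · s(j) is injective on each copy.  As m is squarefree, ℤ/m is the product of the
-- fields 𝔽_q, q ∣ m, and its multiplicative monoid is a disjoint union of abelian groups, whose counts
-- multiply.  For a group of even order N, a half of the two copies with product 1 is obtained from two
-- N/2-subsets with equal product; by Cauchy-Schwarz there are at least C(N, N/2)² / N such pairs.  By
-- Hall's theorem (1952) each half can be arranged as required, and translating the arrangement on
-- each copy gives N² more choices, in total at least 4^N / N.
module Submission where

open import Defs
open import Level using (0ℓ)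
open import Algebra.Bundles using (AbelianGroup)
open import Algebra.Structures using (IsAbelianGroup)
import Algebra.Properties.AbelianGroup
import Algebra.Properties.CommutativeMonoid.Mult
import Algebra.Properties.CommutativeMonoid.Sum
import Algebra.Solver.CommutativeMonoid
open import Data.Bool.Base using (Bool; true; false; T; not; _∨_)
open import Data.Bool.Properties using (T-∧; T?)
open import Data.Empty using (⊥)
open import Data.Fin.Base as Fin using (Fin; zero; suc; toℕ; fromℕ<; splitAt; remQuot; combine; punchOut)
open import Data.Fin.Permutation using (transpose)
import Data.Fin.Properties as Finₚ
open import Data.Integer.Base as ℤ using (ℤ; +_; 0ℤ; 1ℤ; -1ℤ)
open import Data.Integer.Divisibility.Signed as ℤ∣ using (∣⇒∣ᵤ; ∣ᵤ⇒∣)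
import Data.Integer.Properties as ℤₚ
open import Data.Integer.Tactic.RingSolver using () renaming (solve-∀ to solve-ℤ)
open import Data.List using (List; []; _∷_; _++_; length; lookup; map; filter; replicate; allFin; upTo; applyUpTo; cartesianProduct)
open import Data.List.Membership.DecPropositional using (_∈?_)
open import Data.List.Membership.Propositional using (_∈_; _∉_)
open import Data.List.Membership.Propositional.Properties
  using (∈-filter⁺; ∈-filter⁻; ∈-allFin; ∈-map⁺; ∈-map⁻; ∈-cartesianProduct⁻; ∈-lookup; ∈-upTo⁺; ∈-upTo⁻; ∈-concatMap⁺)
open import Data.List.Properties using (filter-notAll; length-++; length-map; length-replicate; length-upTo; map-∘)
open import Data.List.Relation.Unary.All as All using (All; []; _∷_)
import Data.List.Relation.Unary.All.Properties as Allₚ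
open import Data.List.Relation.Unary.AllPairs using ([]; _∷_)
open import Data.List.Relation.Unary.Any as Any using (Any; here; there)
import Data.List.Relation.Unary.Any.Properties as Anyₚ
open import Data.List.Relation.Unary.Unique.Propositional using (Unique)
import Data.List.Relation.Unary.Unique.Propositional.Properties as Uniqueₚ
open import Data.Nat
  using (ℕ; zero; suc; pred; _+_; _*_; _∸_; _^_; _≤_; _<_; _%_; _/_; ∣_-_∣; _≡ᵇ_; _≤?_; NonZero; ≢-nonZero; z≤n; s≤s; z<s; s≤s⁻¹; _!)
open import Data.Nat.Coprimality as Coprimality using (Coprime; coprime-divisor; coprime-Bézout)
open import Data.Nat.Divisibility
  using (_∣_; divides; _∣?_; 1∣_; ∣-refl; ∣-trans; m∣m*n; n∣m*n; ∣1⇒≡1; ∣m+n∣m⇒∣n; >⇒∤)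
open import Data.Nat.DivMod
  using (_mod_; m≡m%n+[m/n]*n; %-distribˡ-*; m%n%n≡m%n; m<n⇒m%n≡m; m%n<n; [m+kn]%n≡m%n)
open import Data.Nat.GCD using (module Bézout)
open import Data.Nat.ListAction using (product)
open import Data.Nat.Primality using (Prime; euclidsLemma; prime⇒irreducible; ¬prime[0]; ¬prime[1]; prime[2])
open import Data.Nat.Properties
open import Data.Nat.Tactic.RingSolver using (solve-∀)
open import Data.Product as Product using (∃-syntax; Σ-syntax; _×_; _,_; proj₁; proj₂; map₂)
open import Data.Product.Function.NonDependent.Propositional using (_×-↔_)
open import Data.Product.Properties using (,-injective; ,-injectiveˡ; ,-injectiveʳ)
open import Data.Sum as Sum using (_⊎_; inj₁; inj₂; [_,_]′)
open import Data.Sum.Properties using (inj₁-injective; inj₂-injective)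
open import Data.Unit using (⊤; tt)
open import Function using (_∘_; case_of_; _↔_; Inverse; Equivalence; Injection; mk↔ₛ′)
open import Function.Construct.Composition using (_↔-∘_)
open import Function.Construct.Identity using (↔-id)
open import Function.Construct.Symmetry using (↔-sym)
open import Function.Properties.Inverse using (↔⇒↣)
open import Relation.Binary.PropositionalEquality
open import Relation.Nullary using (¬_; yes; no; contradiction)
open import Relation.Nullary.Decidable using (¬?; _×-dec_; toWitness)
open import Relation.Unary using (Decidable)

-- Arranging a sequence of product 1 in an abelian group

-- If `b = c ∙ D` with `b` and `c` each running once through the group, then `D` has product `ε`.
-- This necessary condition is why subsets of equal product are paired, the second one inverted so
-- that the products cancel.
--
-- Write m = 2Q. The groups are indexed by the sets of prime divisors of m, each of order the
-- product of q - 1 over its set. This is even except for the empty set and {2}. These two trivial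
-- groups have no halves, and only the identity and the exchange of the two copies are used there: 2
-- members instead of 4^N / N = 4.
--
-- Let Φ be the product of the q - 1 over the odd q, and E = 2^k. The number C of members obtained
-- satisfies 16^(2Q) ≤ 16 C² Φ^(2E). The factor (k+2)! 3^(k+1) of the theorem does not come out of
-- the construction; it fits into the gap between Φ^(2E) and (4Q)^(3E) 2^E. The gap is wide enough
-- for k ≥ 1. For k = 0, that is n = 6, it is not, and the count is evaluated outright.

record FinGroup : Set₁ where
  infixl 7 _∙_
  field
    Carrier        : Set
    _∙_            : Carrier → Carrier → Carrier
    ε              : Carrier
    _⁻¹            : Carrier → Carrier
    isAbelianGroup : IsAbelianGroup _≡_ _∙_ ε _⁻¹
    size           : ℕ
    enum           : Fin size ↔ Carrier

  abelianGroup : AbelianGroup 0ℓ 0ℓ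
  abelianGroup = record { isAbelianGroup = isAbelianGroup }

  open AbelianGroup abelianGroup public
    using (assoc; comm; identityˡ; identityʳ; inverseˡ; inverseʳ; commutativeMonoid; group)
  open Algebra.Properties.AbelianGroup abelianGroup public
    using (∙-cancelˡ; ∙-cancelʳ; ⁻¹-∙-comm; ⁻¹-involutive; ⁻¹-injective; ε⁻¹≈ε; inverseˡ-unique)
  open Algebra.Properties.CommutativeMonoid.Sum commutativeMonoid public
    renaming (sum to ∏) using (sum-cong-≗; ∑-distrib-+; sum-permute; sum-replicate)

to-injective : {A B : Set} (f : A ↔ B) {x y : A} → Inverse.to f x ≡ Inverse.to f y → x ≡ y
to-injective f = Injection.injective (↔⇒↣ f)

transpose-first : ∀ {n} (i j : Fin n) → Inverse.to (transpose i j) i ≡ j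
transpose-first i j with i Finₚ.≟ i
... | yes _  = refl
... | no i≢i = contradiction refl i≢i

transpose-second : ∀ {n} (i j : Fin n) → Inverse.to (transpose i j) j ≡ i
transpose-second i j with j Finₚ.≟ i
... | yes refl = refl
... | no _ with j Finₚ.≟ j
...   | yes _  = refl
...   | no j≢j = contradiction refl j≢j

transpose-other : ∀ {n} (i j : Fin n) {k} → k ≢ i → k ≢ j → Inverse.to (transpose i j) k ≡ k
transpose-other i j {k} k≢i k≢j with k Finₚ.≟ i
... | yes k≡i = contradiction k≡i k≢i
... | no _ with k Finₚ.≟ j
...   | yes k≡j = contradiction k≡j k≢j
...   | no _  = refl

module Hall (G : FinGroup) where
  open FinGroup G
  open Inverse using (to; from)
  open Algebra.Solver.CommutativeMonoid commutativeMonoid using (solve; _⊕_; _⊜_)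

  Arrangement : ℕ → Set
  Arrangement n = Fin n ↔ Carrier

  -- Only x and y may violate b = c ∙ D.  Giving x the value it needs takes that value from some z;
  -- z then moves to the place c y left free at y, and z and y are the new violators.  The product
  -- c x ∙ c y ∙ D x is invariant, which forbids an index that was already moved from being chosen
  -- again, so the unmoved indices, listed in rest, run out.
  repair : ∀ {n} (D : Fin n → Carrier) fuel (x y : Fin n) (c b : Arrangement n) (rest : List (Fin n)) →
    length rest < fuel → x ≢ y → x ∉ rest → y ∉ rest →
    (∀ i → i ≢ x → i ≢ y → to b i ≡ to c i ∙ D i) →
    (∀ v u → v ≢ x → v ≢ y → v ∉ rest → u ≡ y ⊎ u ∈ rest →
      to b v ∙ to c u ≢ to c x ∙ to c y ∙ D x) →
    Σ[ c′ ∈ Arrangement n ] Σ[ b′ ∈ Arrangement n ] (∀ i → i ≢ y → to b′ i ≡ to c′ i ∙ D i)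
  repair D (suc fuel) x y c b rest (s≤s len) x≢y x∉ y∉ ok unmoved
    with from b (to c x ∙ D x) in eqz
  ... | z = choose (z Finₚ.≟ x) (z Finₚ.≟ y)
    where
    bz : to b z ≡ to c x ∙ D x
    bz = trans (cong (to b) (sym eqz)) (Inverse.strictlyInverseˡ b _)

    choose : _ → _ → _
    choose (yes refl) _ = c , b , good
      where
      good : ∀ i → i ≢ y → to b i ≡ to c i ∙ D i
      good i i≢y with i Finₚ.≟ x
      ... | yes refl = bz
      ... | no i≢x   = ok i i≢x i≢y
    choose (no _) (yes refl) = c , b ↔-∘ transpose x y , good
      where
      good : ∀ i → i ≢ y → to b (to (transpose x y) i) ≡ to c i ∙ D i
      good i i≢y = case i Finₚ.≟ x of λ where
        (yes refl) → trans (cong (to b) (transpose-first x y)) bz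
        (no i≢x)   → trans (cong (to b) (transpose-other x y i≢x i≢y)) (ok i i≢x i≢y)
    choose (no z≢x) (no z≢y) with _∈?_ Finₚ._≟_ z rest
    -- By the choice of `z`, `b z ∙ c y` is the invariant product itself, which `unmoved` forbids
    -- for an index that was already moved.
    ... | no z∉ = contradiction
            (trans (cong (_∙ to c y) bz) (solve 3 (λ p q r → (p ⊕ r) ⊕ q ⊜ (p ⊕ q) ⊕ r) refl _ _ _))
            (unmoved z y z≢x z≢y z∉ (inj₁ refl))
    ... | yes z∈ = repair D fuel z y c′ b′ rest′ shorter z≢y z∉′ y∉′ ok′ unmoved′
      where
      c′ = c ↔-∘ transpose z y
      b′ = b ↔-∘ transpose x z
      isn't-z? = λ i → ¬? (i Finₚ.≟ z)
      rest′ = filter isn't-z? rest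

      shorter : length rest′ < fuel
      shorter = <-≤-trans
        (filter-notAll isn't-z? rest (Any.map (λ z≡w w≢z → w≢z (sym z≡w)) z∈)) len

      z∉′ : z ∉ rest′
      z∉′ p = proj₂ (∈-filter⁻ isn't-z? {xs = rest} p) refl

      y∉′ : y ∉ rest′
      y∉′ p = y∉ (proj₁ (∈-filter⁻ isn't-z? {xs = rest} p))

      c′-z : to c′ z ≡ to c y
      c′-z = cong (to c) (transpose-first z y)
      c′-y : to c′ y ≡ to c z
      c′-y = cong (to c) (transpose-second z y)
      c′-other : ∀ {i} → i ≢ z → i ≢ y → to c′ i ≡ to c i
      c′-other p q = cong (to c) (transpose-other z y p q)
      b′-x : to b′ x ≡ to b z
      b′-x = cong (to b) (transpose-first x z)
      b′-other : ∀ {i} → i ≢ x → i ≢ z → to b′ i ≡ to b i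
      b′-other p q = cong (to b) (transpose-other x z p q)

      ok′ : ∀ i → i ≢ z → i ≢ y → to b′ i ≡ to c′ i ∙ D i
      ok′ i i≢z i≢y = case i Finₚ.≟ x of λ where
        (yes refl) → trans b′-x (trans bz (cong (_∙ D x) (sym (c′-other i≢z i≢y))))
        (no i≢x)   → trans (b′-other i≢x i≢z)
                       (trans (ok i i≢x i≢y) (cong (_∙ D i) (sym (c′-other i≢z i≢y))))

      newK : to c′ z ∙ to c′ y ∙ D z ≡ to b z ∙ to c y
      newK = begin
        to c′ z ∙ to c′ y ∙ D z ≡⟨ cong₂ (λ u v → u ∙ v ∙ D z) c′-z c′-y ⟩
        to c y ∙ to c z ∙ D z   ≡⟨ solve 3 (λ p q r → (p ⊕ q) ⊕ r ⊜ (q ⊕ r) ⊕ p) refl _ _ _ ⟩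
        to c z ∙ D z ∙ to c y   ≡⟨ cong (_∙ to c y) (sym (ok z z≢x z≢y)) ⟩
        to b z ∙ to c y         ∎
        where open ≡-Reasoning

      sameK : to c′ z ∙ to c′ y ∙ D z ≡ to c x ∙ to c y ∙ D x
      sameK = trans newK (trans (cong (_∙ to c y) bz)
        (solve 3 (λ p q r → (p ⊕ r) ⊕ q ⊜ (p ⊕ q) ⊕ r) refl _ _ _))

      unmoved′ : ∀ v u → v ≢ z → v ≢ y → v ∉ rest′ → u ≡ y ⊎ u ∈ rest′ →
        to b′ v ∙ to c′ u ≢ to c′ z ∙ to c′ y ∙ D z
      unmoved′ v u v≢z v≢y v∉ u∈ eq = case v Finₚ.≟ x of λ where
          -- `x` has just become a moved index. Meeting the invariant would force `c′ u` to be
          -- `c y`, which now sits at `z`, and `z` has left `rest`.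
          (yes refl) → u≢z u∈ (to-injective c′ (trans
              (∙-cancelˡ (to b z) _ _ (trans (cong (_∙ to c′ u) (sym b′-x)) (trans eq newK)))
              (sym c′-z)))
          (no v≢x) → old v≢x u∈
        where
        u≢z : u ≡ y ⊎ u ∈ rest′ → u ≢ z
        u≢z (inj₁ refl) p = z≢y (sym p)
        u≢z (inj₂ q) refl = z∉′ q

        v∉rest : v ∉ rest
        v∉rest q = v∉ (∈-filter⁺ isn't-z? q v≢z)

        old : v ≢ x → u ≡ y ⊎ u ∈ rest′ → ⊥
        -- The place `y` now carries the value that `c` had at `z`, so the old hypothesis is applied
        -- at `z`, then still in `rest`.
        old v≢x (inj₁ refl) = unmoved v z v≢x v≢y v∉rest (inj₂ z∈)
          (trans (cong₂ _∙_ (sym (b′-other v≢x v≢z)) (sym c′-y)) (trans eq sameK))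
        old v≢x (inj₂ q) with ∈-filter⁻ isn't-z? {xs = rest} q
        ... | u∈rest , u≢z = unmoved v u v≢x v≢y v∉rest (inj₂ u∈rest)
          (trans (cong₂ _∙_ (sym (b′-other v≢x v≢z)) (sym (c′-other u≢z λ { refl → y∉ u∈rest })))
            (trans eq sameK))

  exchange : ∀ {n} (D : Fin n → Carrier) (x y : Fin n) → x ≢ y → (c b : Arrangement n) →
    (∀ i → i ≢ x → i ≢ y → to b i ≡ to c i ∙ D i) →
    Σ[ c′ ∈ Arrangement n ] Σ[ b′ ∈ Arrangement n ] (∀ i → i ≢ y → to b′ i ≡ to c′ i ∙ D i)
  exchange {n} D x y x≢y c b ok = repair D (suc (length others)) x y c b others (n<1+n _) x≢y
    (λ p → proj₁ (proj₂ (∈-filter⁻ other? {xs = allFin n} p)) refl)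
    (λ p → proj₂ (proj₂ (∈-filter⁻ other? {xs = allFin n} p)) refl)
    ok
    -- At the start no index has been moved, so this condition is vacuous.
    (λ v u v≢x v≢y v∉ _ → contradiction (∈-filter⁺ other? (∈-allFin v) (v≢x , v≢y)) v∉)
    where
    other? = λ i → ¬? (i Finₚ.≟ x) ×-dec ¬? (i Finₚ.≟ y)
    others = filter other? (allFin n)

  -- Index `zero` serves as the dump for all defects, and the prescribed values of `D` are enforced
  -- at one further index at a time.
  arrangeOn : ∀ {n} (D : Fin (suc n) → Carrier) → Fin (suc n) ↔ Carrier → (xs : List (Fin n)) →
    Σ[ c ∈ Arrangement (suc n) ] Σ[ b ∈ Arrangement (suc n) ]
      (∀ i → i ∈ xs → to b (suc i) ≡ to c (suc i) ∙ D (suc i))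
  arrangeOn D e []       = e , e , λ _ ()
  arrangeOn {n} D e (x ∷ xs) with arrangeOn D e xs
  ... | c , b , good = c′ , b′ , good″
    where
    open ≡-Reasoning
    -- `exchange` wants every index but two to be correct already. Indices not yet treated are made
    -- correct by prescribing the quotient they happen to have; at treated indices `D′` agrees with
    -- `D`.
    D′ : Fin (suc n) → Carrier
    D′ i with i Finₚ.≟ suc x
    ... | yes _ = D i
    ... | no  _ = to c i ⁻¹ ∙ to b i

    D′-x : D′ (suc x) ≡ D (suc x)
    D′-x with suc x Finₚ.≟ suc x
    ... | yes _ = refl
    ... | no ¬p = contradiction refl ¬p

    kept : ∀ i → i ≢ suc x → to b i ≡ to c i ∙ D′ i
    kept i i≢x with i Finₚ.≟ suc x
    ... | yes i≡x = contradiction i≡x i≢x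
    ... | no _ = begin
      to b i                      ≡⟨ identityˡ _ ⟨
      ε ∙ to b i                  ≡⟨ cong (_∙ to b i) (inverseʳ (to c i)) ⟨
      to c i ∙ to c i ⁻¹ ∙ to b i ≡⟨ assoc _ _ _ ⟩
      to c i ∙ (to c i ⁻¹ ∙ to b i) ∎

    step = exchange D′ (suc x) zero (λ ()) c b (λ i p _ → kept i p)
    c′ = proj₁ step
    b′ = proj₁ (proj₂ step)
    good′ = proj₂ (proj₂ step)

    good″ : ∀ i → i ∈ x ∷ xs → to b′ (suc i) ≡ to c′ (suc i) ∙ D (suc i)
    good″ i i∈ with i Finₚ.≟ x
    ... | yes refl = trans (good′ (suc i) λ ()) (cong (to c′ (suc i) ∙_) D′-x)
    good″ i (here i≡x) | no i≢x = contradiction i≡x i≢x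
    good″ i (there i∈) | no i≢x = trans (good′ (suc i) λ ()) (cong (to c′ (suc i) ∙_)
      (∙-cancelˡ (to c (suc i)) _ _
        (trans (sym (kept (suc i) λ { refl → i≢x refl })) (good i i∈))))

  ∏-enum : ∀ {n} (c b : Arrangement n) → ∏ (to c) ≡ ∏ (to b)
  ∏-enum c b = trans (sum-permute (to c) (↔-sym c ↔-∘ b))
    (sum-cong-≗ (λ i → Inverse.strictlyInverseˡ c (to b i)))

  -- All equations but the one at `zero` come from `arrangeOn`. That last one is forced: `b` and `c`
  -- have the same total product and `D` has product `ε`, so the other factors cancel.
  hall : ∀ {n} (D : Fin n → Carrier) → Arrangement n → ∏ D ≡ ε →
    Σ[ c ∈ Arrangement n ] Σ[ b ∈ Arrangement n ] (∀ i → to b i ≡ to c i ∙ D i)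
  hall {zero}  D e _ = e , e , λ ()
  hall {suc n} D e ∏D with arrangeOn D e (allFin n)
  ... | c , b , good = c , b , λ { zero → good₀ ; (suc i) → good i (∈-allFin i) }
    where
    open ≡-Reasoning
    tail-b = λ i → to b (suc i)
    good₀ : to b zero ≡ to c zero ∙ D zero
    good₀ = ∙-cancelʳ (∏ tail-b) _ _ (begin
      ∏ (to b)                                     ≡⟨ ∏-enum b c ⟩
      ∏ (to c)                                     ≡⟨ identityʳ _ ⟨
      ∏ (to c) ∙ ε                                 ≡⟨ cong (∏ (to c) ∙_) ∏D ⟨
      ∏ (to c) ∙ ∏ D                               ≡⟨ ∑-distrib-+ (to c) D ⟨
      ∏ (λ i → to c i ∙ D i)                       ≡⟨ cong (to c zero ∙ D zero ∙_) (sum-cong-≗ (λ i → good i (∈-allFin i))) ⟨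
      to c zero ∙ D zero ∙ ∏ tail-b                ∎)

-- Counting pairs of subsets

-- Carrying the size of the complement as an index of its own treats a subset and its complement
-- symmetrically and enumerates both by `Fin`.
data Subset : ℕ → ℕ → ℕ → Set where
  []   : Subset 0 0 0
  in∷_  : ∀ {n a b} → Subset n a b → Subset (suc n) (suc a) b
  out∷_ : ∀ {n a b} → Subset n a b → Subset (suc n) a (suc b)

inside : ∀ {n a b} → Subset n a b → Fin a → Fin n
inside (in∷ s) zero     = zero
inside (in∷ s) (suc i)  = suc (inside s i)
inside (out∷ s) i       = suc (inside s i)

outside : ∀ {n a b} → Subset n a b → Fin b → Fin n
outside (in∷ s) i        = suc (outside s i)
outside (out∷ s) zero    = zero
outside (out∷ s) (suc i) = suc (outside s i)

inside-injective : ∀ {n a b} (s : Subset n a b) {i j} → inside s i ≡ inside s j → i ≡ j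
inside-injective (in∷ s) {zero} {zero} _   = refl
inside-injective (in∷ s) {suc i} {suc j} p = cong suc (inside-injective s (Finₚ.suc-injective p))
inside-injective (out∷ s) p                = inside-injective s (Finₚ.suc-injective p)

outside-injective : ∀ {n a b} (s : Subset n a b) {i j} → outside s i ≡ outside s j → i ≡ j
outside-injective (in∷ s) p                  = outside-injective s (Finₚ.suc-injective p)
outside-injective (out∷ s) {zero} {zero} _   = refl
outside-injective (out∷ s) {suc i} {suc j} p = cong suc (outside-injective s (Finₚ.suc-injective p))

inside≢outside : ∀ {n a b} (s : Subset n a b) {i j} → inside s i ≢ outside s j
inside≢outside (in∷ s) {suc i} p       = inside≢outside s (Finₚ.suc-injective p)
inside≢outside (out∷ s) {i} {suc j} p  = inside≢outside s (Finₚ.suc-injective p)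

private
  cancel-suc : ∀ {n m k} {f : Fin m → Fin n} {g : Fin k → Fin n} →
    (∀ i → ∃[ j ] suc (f i) ≡ suc (g j)) → ∀ i → ∃[ j ] f i ≡ g j
  cancel-suc h i with h i
  ... | j , p = j , Finₚ.suc-injective p

-- If the first disagreement is an element of `s` only, the first inclusion fails; if it is an
-- element of `t` only, the inclusion of complements fails.
subset-ext : ∀ {n a b} (s t : Subset n a b) →
  (∀ i → ∃[ j ] inside s i ≡ inside t j) → (∀ i → ∃[ j ] outside s i ≡ outside t j) → s ≡ t
subset-ext [] [] _ _ = refl
subset-ext (in∷ s) (in∷ t) p q = cong in∷_ (subset-ext s t p′ (cancel-suc q))
  where
  p′ : ∀ i → ∃[ j ] inside s i ≡ inside t j
  p′ i with p (suc i)
  ... | suc j , r = j , Finₚ.suc-injective r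
subset-ext (in∷ s) (out∷ t) p q = contradiction (proj₂ (p zero)) λ ()
subset-ext (out∷ s) (in∷ t) p q = contradiction (proj₂ (q zero)) λ ()
subset-ext (out∷ s) (out∷ t) p q = cong out∷_ (subset-ext s t (cancel-suc p) q′)
  where
  q′ : ∀ i → ∃[ j ] outside s i ≡ outside t j
  q′ i with q (suc i)
  ... | suc j , r = j , Finₚ.suc-injective r

subsets : ∀ n a b → List (Subset n a b)
subsets zero    zero    zero    = [] ∷ []
subsets zero    zero    (suc b) = []
subsets zero    (suc a) b       = []
subsets (suc n) zero    zero    = []
subsets (suc n) (suc a) zero    = map in∷_ (subsets n a zero)
subsets (suc n) zero    (suc b) = map out∷_ (subsets n zero b)
subsets (suc n) (suc a) (suc b) = map in∷_ (subsets n a (suc b)) ++ map out∷_ (subsets n (suc a) b)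

subsets-unique : ∀ n a b → Unique (subsets n a b)
subsets-unique zero    zero    zero    = [] ∷ []
subsets-unique zero    zero    (suc b) = []
subsets-unique zero    (suc a) b       = []
subsets-unique (suc n) zero    zero    = []
subsets-unique (suc n) (suc a) zero    = Uniqueₚ.map⁺ (λ { refl → refl }) (subsets-unique n a zero)
subsets-unique (suc n) zero    (suc b) = Uniqueₚ.map⁺ (λ { refl → refl }) (subsets-unique n zero b)
subsets-unique (suc n) (suc a) (suc b) = Uniqueₚ.++⁺
  (Uniqueₚ.map⁺ (λ { refl → refl }) (subsets-unique n a (suc b)))
  (Uniqueₚ.map⁺ (λ { refl → refl }) (subsets-unique n (suc a) b))
  λ (p , q) → clash (proj₂ (proj₂ (∈-map⁻ in∷_ p))) (proj₂ (proj₂ (∈-map⁻ out∷_ q)))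
  where
  clash : ∀ {s t v} → v ≡ in∷ s → v ≡ out∷ t → ⊥
  clash refl ()

-- Pascal's rule for the binomial coefficient, cleared of denominators: the two summands receive the
-- weights `suc a` and `suc b`, whose sum is the new factor of the factorial.
length-subsets : ∀ a b → length (subsets (a + b) a b) * (a ! * b !) ≡ (a + b) !
length-subsets zero zero = refl
length-subsets zero (suc b) = begin
  length (map out∷_ (subsets b zero b)) * (1 * (suc b * b !))
    ≡⟨ cong (_* (1 * (suc b * b !))) (length-map out∷_ (subsets b zero b)) ⟩
  L * (1 * (suc b * b !)) ≡⟨ ring L b (b !) ⟩
  suc b * (L * (1 * b !)) ≡⟨ cong (suc b *_) (length-subsets zero b) ⟩
  suc b * b !             ∎
  where
  open ≡-Reasoning
  L = length (subsets b zero b)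
  ring : ∀ l b f → l * (1 * ((1 + b) * f)) ≡ (1 + b) * (l * (1 * f))
  ring = solve-∀
length-subsets (suc a) zero = begin
  length (map in∷_ (subsets (a + 0) a zero)) * (suc a * a ! * 1)
    ≡⟨ cong (_* (suc a * a ! * 1)) (length-map in∷_ (subsets (a + 0) a zero)) ⟩
  L * (suc a * a ! * 1)         ≡⟨ ring L a (a !) ⟩
  suc (a + 0) * (L * (a ! * 1)) ≡⟨ cong (suc (a + 0) *_) (length-subsets a zero) ⟩
  suc (a + 0) * (a + 0) !       ∎
  where
  open ≡-Reasoning
  L = length (subsets (a + 0) a zero)
  ring : ∀ l a f → l * ((1 + a) * f * 1) ≡ (1 + (a + 0)) * (l * (f * 1))
  ring = solve-∀
length-subsets (suc a) (suc b) = begin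
  length (map in∷_ Ls ++ map out∷_ Rs) * (suc a * a ! * (suc b * b !))
    ≡⟨ cong (_* (suc a * a ! * (suc b * b !))) (trans (length-++ (map in∷_ Ls))
         (cong₂ _+_ (length-map in∷_ Ls) (length-map out∷_ Rs))) ⟩
  (L + R) * (suc a * a ! * (suc b * b !))
    ≡⟨ ring L R a b (a !) (b !) ⟩
  suc a * (L * (a ! * (suc b * b !))) + suc b * (R * (suc a * a ! * b !))
    ≡⟨ cong₂ (λ x y → suc a * x + suc b * y) (length-subsets a (suc b)) R-count ⟩
  suc a * (a + suc b) ! + suc b * (a + suc b) !
    ≡⟨ ring′ a b ((a + suc b) !) ⟩
  suc (a + suc b) * (a + suc b) ! ∎
  where
  open ≡-Reasoning
  Ls = subsets (a + suc b) a (suc b)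
  Rs = subsets (a + suc b) (suc a) b
  L = length Ls
  R = length Rs
  R-count : R * (suc a * a ! * b !) ≡ (a + suc b) !
  R-count = subst (λ n → length (subsets n (suc a) b) * (suc a * a ! * b !) ≡ n !)
    (sym (+-suc a b)) (length-subsets (suc a) b)
  ring : ∀ l r a b f g → (l + r) * ((1 + a) * f * ((1 + b) * g)) ≡
    (1 + a) * (l * (f * ((1 + b) * g))) + (1 + b) * (r * ((1 + a) * f * g))
  ring = solve-∀
  ring′ : ∀ a b f → (1 + a) * f + (1 + b) * f ≡ (1 + (a + (1 + b))) * f
  ring′ = solve-∀

centralBinomial : ℕ → ℕ
centralBinomial h = length (subsets (h + h) h h)

centralBinomial-suc : ∀ h → suc h * centralBinomial (suc h) ≡ 2 * (1 + 2 * h) * centralBinomial h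
centralBinomial-suc h = *-cancelʳ-≡ _ _ (suc h * (h ! * h !))
  {{m*n≢0 (suc h) (h ! * h !) {{_}} {{h !* h !≢0}}}} (begin
  suc h * B′ * (suc h * (h ! * h !))            ≡⟨ ring₁ h B′ (h !) ⟩
  B′ * (suc h * h ! * (suc h * h !))            ≡⟨ length-subsets (suc h) (suc h) ⟩
  (suc h + suc h) !                             ≡⟨ cong (_!) (cong suc (+-suc h h)) ⟩
  suc (suc (h + h)) * (suc (h + h) * (h + h) !) ≡⟨ cong (λ x → suc (suc (h + h)) * (suc (h + h) * x)) (length-subsets h h) ⟨
  suc (suc (h + h)) * (suc (h + h) * (B * (h ! * h !))) ≡⟨ ring₂ h B (h !) ⟩
  2 * (1 + 2 * h) * B * (suc h * (h ! * h !))   ∎)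
  where
  open ≡-Reasoning
  B = centralBinomial h
  B′ = centralBinomial (suc h)
  ring₁ : ∀ h b f → (1 + h) * b * ((1 + h) * (f * f)) ≡ b * ((1 + h) * f * ((1 + h) * f))
  ring₁ = solve-∀
  ring₂ : ∀ h b f → (2 + (h + h)) * ((1 + (h + h)) * (b * (f * f))) ≡ 2 * (1 + 2 * h) * b * ((1 + h) * (f * f))
  ring₂ = solve-∀

-- Passing from k to k + 1 multiplies 2k C(2k, k) by 2(2k + 1)/k, which exceeds 4; the induction
-- starts with equality at 1.
4^h≤2h*centralBinomial : ∀ h → 4 ^ suc h ≤ (suc h + suc h) * centralBinomial (suc h)
4^h≤2h*centralBinomial zero = ≤-refl
4^h≤2h*centralBinomial (suc h) = begin
  4 * 4 ^ suc h                              ≤⟨ *-monoʳ-≤ 4 (4^h≤2h*centralBinomial h) ⟩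
  4 * ((k + k) * B)                          ≡⟨ ring₁ k B ⟩
  4 * (2 * k) * B                            ≤⟨ *-monoˡ-≤ B (*-monoʳ-≤ 4 (n≤1+n (2 * k))) ⟩
  4 * (1 + 2 * k) * B                        ≡⟨ ring₂ k B ⟩
  2 * (2 * (1 + 2 * k) * B)                  ≡⟨ cong (2 *_) (centralBinomial-suc k) ⟨
  2 * (suc k * centralBinomial (suc k))      ≡⟨ ring₃ (suc k) (centralBinomial (suc k)) ⟩
  (suc k + suc k) * centralBinomial (suc k)  ∎
  where
  open ≤-Reasoning
  k = suc h
  B = centralBinomial k
  ring₁ : ∀ k b → 4 * ((k + k) * b) ≡ 4 * (2 * k) * b
  ring₁ = solve-∀
  ring₂ : ∀ k b → 4 * (1 + 2 * k) * b ≡ 2 * (2 * (1 + 2 * k) * b)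
  ring₂ = solve-∀
  ring₃ : ∀ k b → 2 * (k * b) ≡ (k + k) * b
  ring₃ = solve-∀

length-filter-∁ : {A : Set} {P : A → Set} (P? : Decidable P) (xs : List A) →
  length (filter P? xs) + length (filter (¬? ∘ P?) xs) ≡ length xs
length-filter-∁ P? [] = refl
length-filter-∁ P? (x ∷ xs) with P? x
... | yes _ = cong suc (length-filter-∁ P? xs)
... | no _  = trans (+-suc _ _) (cong suc (length-filter-∁ P? xs))

2mn≤m²+n² : ∀ m n → 2 * (m * n) ≤ m * m + n * n
2mn≤m²+n² m n with ≤-total m n
... | inj₁ m≤n with m≤n⇒∃[o]m+o≡n m≤n
...   | d , refl = ≤-trans (m≤m+n _ (d * d)) (≤-reflexive (ring m d))
  where
  ring : ∀ m d → 2 * (m * (m + d)) + d * d ≡ m * m + (m + d) * (m + d)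
  ring = solve-∀
2mn≤m²+n² m n | inj₂ n≤m with m≤n⇒∃[o]m+o≡n n≤m
...   | d , refl = ≤-trans (m≤m+n _ (d * d)) (≤-reflexive (ring n d))
  where
  ring : ∀ n d → 2 * ((n + d) * n) + d * d ≡ (n + d) * (n + d) + n * n
  ring = solve-∀

-- One more summand in the Cauchy-Schwarz inequality: `a` is the new term, `b` the sum of `N`
-- others, `Q` stands for their sum of squares. The mixed term `2ab` is bounded after multiplying by
-- the number `M` of old terms, from 2(Ma)b ≤ (Ma)² + b².
cauchySchwarz-step : ∀ N a b Q → b * b ≤ N * Q → (a + b) * (a + b) ≤ suc N * (a * a + Q)
cauchySchwarz-step zero a zero Q _ = begin
  (a + 0) * (a + 0) ≡⟨ cong₂ _*_ (+-identityʳ a) (+-identityʳ a) ⟩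
  a * a             ≤⟨ m≤m+n _ Q ⟩
  a * a + Q         ≡⟨ +-identityʳ _ ⟨
  1 * (a * a + Q)   ∎
  where open ≤-Reasoning
cauchySchwarz-step (suc N) a b Q b²≤ = begin
  (a + b) * (a + b)                       ≡⟨ ring₁ a b ⟩
  a * a + 2 * (a * b) + b * b             ≤⟨ +-mono-≤ (+-monoʳ-≤ (a * a) cross) b²≤ ⟩
  a * a + (M * (a * a) + Q) + M * Q       ≡⟨ ring₂ M a Q ⟩
  suc M * (a * a + Q)                     ∎
  where
  open ≤-Reasoning
  M = suc N
  ring₁ : ∀ a b → (a + b) * (a + b) ≡ a * a + 2 * (a * b) + b * b
  ring₁ = solve-∀
  ring₂ : ∀ M a Q → a * a + (M * (a * a) + Q) + M * Q ≡ (1 + M) * (a * a + Q)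
  ring₂ = solve-∀
  ring₃ : ∀ M a b → M * (2 * (a * b)) ≡ 2 * (M * a * b)
  ring₃ = solve-∀
  ring₄ : ∀ M a Q → M * a * (M * a) + M * Q ≡ M * (M * (a * a) + Q)
  ring₄ = solve-∀
  cross : 2 * (a * b) ≤ M * (a * a) + Q
  cross = *-cancelˡ-≤ M (begin
    M * (2 * (a * b))             ≡⟨ ring₃ M a b ⟩
    2 * (M * a * b)               ≤⟨ 2mn≤m²+n² (M * a) b ⟩
    M * a * (M * a) + b * b       ≤⟨ +-monoʳ-≤ (M * a * (M * a)) b²≤ ⟩
    M * a * (M * a) + M * Q       ≡⟨ ring₄ M a Q ⟩
    M * (M * (a * a) + Q)         ∎)

length-cartesianProduct : {A B : Set} (xs : List A) (ys : List B) →
  length (cartesianProduct xs ys) ≡ length xs * length ys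
length-cartesianProduct []       ys = refl
length-cartesianProduct (x ∷ xs) ys = begin
  length (map (x ,_) ys ++ cartesianProduct xs ys)
    ≡⟨ length-++ (map (x ,_) ys) ⟩
  length (map (x ,_) ys) + length (cartesianProduct xs ys)
    ≡⟨ cong₂ _+_ (length-map (x ,_) ys) (length-cartesianProduct xs ys) ⟩
  length ys + length xs * length ys ∎
  where open ≡-Reasoning

-- Induction on the number of colours: the elements of the top colour contribute all their ordered
-- pairs. The bound `f x < N` is carried along because it separates these new pairs from those
-- already found.
fibrePairs : {A : Set} (f : A → ℕ) (N : ℕ) (xs : List A) → Unique xs → All (λ x → f x < N) xs →
  Σ[ ps ∈ List (A × A) ] Unique ps × All (λ (x , y) → f x < N × f x ≡ f y) ps ×
    length xs * length xs ≤ N * length ps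
fibrePairs f zero [] _ _ = [] , [] , [] , z≤n
fibrePairs f zero (x ∷ xs) _ (() ∷ _)
fibrePairs {A} f (suc N) xs u bounded
  with fibrePairs f N (filter (λ x → ¬? (f x ≟ N)) xs) (Uniqueₚ.filter⁺ (λ x → ¬? (f x ≟ N)) u)
         (All.map (λ (p , q) → ≤∧≢⇒< (≤-pred p) q)
           (All.zip (Allₚ.filter⁺ (λ x → ¬? (f x ≟ N)) bounded , Allₚ.all-filter (λ x → ¬? (f x ≟ N)) xs)))
... | ps , ups , good , count = cartesianProduct ys ys ++ ps
    , Uniqueₚ.++⁺ (Uniqueₚ.cartesianProduct⁺ uys uys) ups
        (λ (p , q) → <-irrefl (proj₂ (∈-filter⁻ top? {xs = xs} (proj₁ (∈-cartesianProduct⁻ ys ys p))))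
          (proj₁ (All.lookup good q)))
    , Allₚ.++⁺ (All.tabulate λ p → same (∈-cartesianProduct⁻ ys ys p))
        (All.map (λ (p , q) → m<n⇒m<1+n p , q) good)
    , bound
  where
  top? = λ x → f x ≟ N
  ys = filter top? xs
  uys = Uniqueₚ.filter⁺ top? u
  zs = filter (¬? ∘ top?) xs

  same : ∀ {x y} → x ∈ ys × y ∈ ys → f x < suc N × f x ≡ f y
  same (p , q) = s≤s (≤-reflexive x) , trans x (sym (proj₂ (∈-filter⁻ top? {xs = xs} q)))
    where x = proj₂ (∈-filter⁻ top? {xs = xs} p)

  bound : length xs * length xs ≤ suc N * length (cartesianProduct ys ys ++ ps)
  bound = begin
    length xs * length xs
      ≡⟨ cong (λ l → l * l) (length-filter-∁ top? xs) ⟨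
    (length ys + length zs) * (length ys + length zs)
      ≤⟨ cauchySchwarz-step N (length ys) (length zs) (length ps) count ⟩
    suc N * (length ys * length ys + length ps)
      ≡⟨ cong (λ l → suc N * (l + length ps)) (length-cartesianProduct ys ys) ⟨
    suc N * (length (cartesianProduct ys ys) + length ps)
      ≡⟨ cong (suc N *_) (length-++ (cartesianProduct ys ys)) ⟨
    suc N * length (cartesianProduct ys ys ++ ps) ∎
    where open ≤-Reasoning

-- Families on a group

-- With A = ℤ/(p-1) under multiplication, the two copies of A in the argument of s are the two parity
-- classes of bases, and those in the value are the two exponents of each residue class.
record Family {A : Set} (_∙_ : A → A → A) (I : Set) : Set where
  field
    s          : I → Bool × A → Bool × A
    injective  : ∀ i {x y} → s i x ≡ s i y → x ≡ y
    ∙-injective : ∀ i κ {a b} → a ∙ proj₂ (s i (κ , a)) ≡ b ∙ proj₂ (s i (κ , b)) → a ≡ b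
    faithful   : ∀ {i j} → (∀ x → s i x ≡ s j x) → i ≡ j

reindex : {A I J : Set} {_∙_ : A → A → A} (f : J → I) → (∀ {i j} → f i ≡ f j → i ≡ j) →
  Family _∙_ I → Family _∙_ J
reindex f f-inj F = record
  { s = s ∘ f ; injective = λ i → injective (f i) ; ∙-injective = λ i → ∙-injective (f i)
  ; faithful = f-inj ∘ faithful }
  where open Family F

remQuot-injective : ∀ m n {i j : Fin (m * n)} → remQuot {m} n i ≡ remQuot n j → i ≡ j
remQuot-injective m n {i} {j} p = trans (sym (Finₚ.combine-remQuot {m} n i))
  (trans (cong (λ (x , y) → combine x y) p) (Finₚ.combine-remQuot {m} n j))

lookup-injective : {A : Set} {xs : List A} → Unique xs → ∀ {i j} → lookup xs i ≡ lookup xs j → i ≡ j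
lookup-injective (x≢ ∷ u) {zero}  {zero}  p = refl
lookup-injective (x≢ ∷ u) {zero}  {suc j} p = contradiction p (All.lookup x≢ (∈-lookup j))
lookup-injective (x≢ ∷ u) {suc i} {zero}  p = contradiction (sym p) (All.lookup x≢ (∈-lookup i))
lookup-injective (x≢ ∷ u) {suc i} {suc j} p = cong suc (lookup-injective u p)

module _ (G : FinGroup) where
  open FinGroup G
  open Inverse using (to; from)
  open Hall G using (hall)

  ∏-++ : ∀ m {n} (f : Fin m → Carrier) (g : Fin n → Carrier) →
    ∏ (λ i → [ f , g ]′ (splitAt m i)) ≡ ∏ f ∙ ∏ g
  ∏-++ zero    f g = sym (identityˡ _)
  ∏-++ (suc m) f g = begin
    f zero ∙ ∏ (λ i → [ f , g ]′ (splitAt (suc m) (suc i)))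
      ≡⟨ cong (f zero ∙_) (sum-cong-≗ (λ i → shift (splitAt m i))) ⟩
    f zero ∙ ∏ (λ i → [ f ∘ suc , g ]′ (splitAt m i)) ≡⟨ cong (f zero ∙_) (∏-++ m (f ∘ suc) g) ⟩
    f zero ∙ (∏ (f ∘ suc) ∙ ∏ g)                      ≡⟨ assoc _ _ _ ⟨
    f zero ∙ ∏ (f ∘ suc) ∙ ∏ g                        ∎
    where
    open ≡-Reasoning
    shift : ∀ x → [ f , g ]′ (Sum.map₁ suc x) ≡ [ f ∘ suc , g ]′ x
    shift (inj₁ _) = refl
    shift (inj₂ _) = refl

  ∏-⁻¹ : ∀ {n} (f : Fin n → Carrier) → ∏ (λ i → f i ⁻¹) ≡ ∏ f ⁻¹
  ∏-⁻¹ {zero}  f = sym ε⁻¹≈ε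
  ∏-⁻¹ {suc n} f = trans (cong (f zero ⁻¹ ∙_) (∏-⁻¹ (f ∘ suc))) (⁻¹-∙-comm _ _)

  ∏-inside-outside : ∀ {n a b} (S : Subset n a b) (f : Fin n → Carrier) →
    ∏ (f ∘ inside S) ∙ ∏ (f ∘ outside S) ≡ ∏ f
  ∏-inside-outside []       f = identityˡ ε
  ∏-inside-outside (in∷ S)  f =
    trans (assoc _ _ _) (cong (f zero ∙_) (∏-inside-outside S (f ∘ suc)))
  ∏-inside-outside (out∷ S) f = begin
    x ∙ (f zero ∙ y) ≡⟨ assoc _ _ _ ⟨
    x ∙ f zero ∙ y   ≡⟨ cong (_∙ y) (comm x (f zero)) ⟩
    f zero ∙ x ∙ y   ≡⟨ assoc _ _ _ ⟩
    f zero ∙ (x ∙ y) ≡⟨ cong (f zero ∙_) (∏-inside-outside S (f ∘ suc)) ⟩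
    ∏ f              ∎
    where
    open ≡-Reasoning
    x = ∏ (f ∘ suc ∘ inside S)
    y = ∏ (f ∘ suc ∘ outside S)

  -- The two members are the identity and the exchange of the copies.
  singletonFamily : size ≡ 1 → Family _∙_ (Fin 2)
  singletonFamily size≡1 = record
    { s = λ i (κ , a) → xor i κ , a
    ; injective = λ i p → cong₂ _,_ (xor-inj i (proj₁ (,-injective p))) (all-equal _ _)
    ; ∙-injective = λ _ _ _ → all-equal _ _
    ; faithful = λ p → xor-faithful (cong proj₁ (p (false , ε))) }
    where
    all-equal : ∀ (a b : Carrier) → a ≡ b
    all-equal a b = trans (sym (Inverse.strictlyInverseˡ enum a))
      (trans (cong (to enum) (one size≡1 _ _)) (Inverse.strictlyInverseˡ enum b))
      where
      one : ∀ {n} → n ≡ 1 → (i j : Fin n) → i ≡ j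
      one refl zero zero = refl
    xor : Fin 2 → Bool → Bool
    xor zero κ = κ
    xor (suc _) κ = not κ
    xor-inj : ∀ i {x y} → xor i x ≡ xor i y → x ≡ y
    xor-inj zero p = p
    xor-inj (suc _) {false} {false} p = refl
    xor-inj (suc _) {true} {true} p = refl
    xor-faithful : ∀ {i j} → xor i false ≡ xor j false → i ≡ j
    xor-faithful {zero} {zero} _ = refl
    xor-faithful {suc zero} {suc zero} _ = refl

  module Halves (h : ℕ) (e : Fin (h + h) ↔ Carrier) where
    Half : Set
    Half = Subset (h + h) h h

    el : Fin (h + h) → Carrier
    el = to e

    total : Half → Carrier
    total S = ∏ (el ∘ inside S)

    -- Copy false receives S in the first layer and T ⁻¹ in the second, copy true the complement; if
    -- S and T have the same product, then both have product ε.
    part : Half × Half → Bool → Fin h ⊎ Fin h → Bool × Carrier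
    part (S , T) false (inj₁ i) = false , el (inside S i)
    part (S , T) false (inj₂ i) = true  , el (inside T i) ⁻¹
    part (S , T) true  (inj₁ i) = false , el (outside S i)
    part (S , T) true  (inj₂ i) = true  , el (outside T i) ⁻¹

    el⁻¹-injective : ∀ {i j} → el i ⁻¹ ≡ el j ⁻¹ → i ≡ j
    el⁻¹-injective = to-injective e ∘ ⁻¹-injective

    part-injective : ∀ ST κ κ′ {i j} → part ST κ i ≡ part ST κ′ j → (κ , i) ≡ (κ′ , j)
    part-injective (S , T) false false {inj₁ i} {inj₁ j} p =
      cong (λ k → false , inj₁ k) (inside-injective S (to-injective e (cong proj₂ p)))
    part-injective (S , T) false false {inj₁ i} {inj₂ j} ()
    part-injective (S , T) false false {inj₂ i} {inj₁ j} ()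
    part-injective (S , T) false false {inj₂ i} {inj₂ j} p =
      cong (λ k → false , inj₂ k) (inside-injective T (el⁻¹-injective (cong proj₂ p)))
    part-injective (S , T) false true  {inj₁ i} {inj₁ j} p =
      contradiction (to-injective e (cong proj₂ p)) (inside≢outside S)
    part-injective (S , T) false true  {inj₁ i} {inj₂ j} ()
    part-injective (S , T) false true  {inj₂ i} {inj₁ j} ()
    part-injective (S , T) false true  {inj₂ i} {inj₂ j} p =
      contradiction (el⁻¹-injective (cong proj₂ p)) (inside≢outside T)
    part-injective (S , T) true  false {inj₁ i} {inj₁ j} p =
      contradiction (sym (to-injective e (cong proj₂ p))) (inside≢outside S)
    part-injective (S , T) true  false {inj₁ i} {inj₂ j} ()
    part-injective (S , T) true  false {inj₂ i} {inj₁ j} ()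
    part-injective (S , T) true  false {inj₂ i} {inj₂ j} p =
      contradiction (sym (el⁻¹-injective (cong proj₂ p))) (inside≢outside T)
    part-injective (S , T) true  true  {inj₁ i} {inj₁ j} p =
      cong (λ k → true , inj₁ k) (outside-injective S (to-injective e (cong proj₂ p)))
    part-injective (S , T) true  true  {inj₁ i} {inj₂ j} ()
    part-injective (S , T) true  true  {inj₂ i} {inj₁ j} ()
    part-injective (S , T) true  true  {inj₂ i} {inj₂ j} p =
      cong (λ k → true , inj₂ k) (outside-injective T (el⁻¹-injective (cong proj₂ p)))

    part-faithful : ∀ ST ST′ → (∀ κ i → ∃[ j ] part ST κ i ≡ part ST′ κ j) → ST ≡ ST′
    part-faithful (S , T) (S′ , T′) p = cong₂ _,_ (subset-ext S S′ in₁ out₁) (subset-ext T T′ in₂ out₂)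
      where
      in₁ : ∀ i → ∃[ j ] inside S i ≡ inside S′ j
      in₁ i with p false (inj₁ i)
      ... | inj₁ j , q = j , to-injective e (cong proj₂ q)
      out₁ : ∀ i → ∃[ j ] outside S i ≡ outside S′ j
      out₁ i with p true (inj₁ i)
      ... | inj₁ j , q = j , to-injective e (cong proj₂ q)
      in₂ : ∀ i → ∃[ j ] inside T i ≡ inside T′ j
      in₂ i with p false (inj₂ i)
      ... | inj₂ j , q = j , el⁻¹-injective (cong proj₂ q)
      out₂ : ∀ i → ∃[ j ] outside T i ≡ outside T′ j
      out₂ i with p true (inj₂ i)
      ... | inj₂ j , q = j , el⁻¹-injective (cong proj₂ q)

    label : Half × Half → Bool → Fin (h + h) → Bool × Carrier
    label ST κ i = part ST κ (splitAt h i)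

    label-injective : ∀ ST {κ κ′ i j} → label ST κ i ≡ label ST κ′ j → (κ , i) ≡ (κ′ , j)
    label-injective ST {κ} {κ′} {i} {j} p with part-injective ST κ κ′ p
    ... | q = cong₂ _,_ (cong proj₁ q) (trans (sym (Finₚ.join-splitAt h h i))
                (trans (cong (Fin.join h h ∘ proj₂) q) (Finₚ.join-splitAt h h j)))

    ∏-part : ∀ S T κ → ∏ (proj₂ ∘ label (S , T) κ) ≡
      ∏ (λ i → proj₂ (part (S , T) κ (inj₁ i))) ∙ ∏ (λ i → proj₂ (part (S , T) κ (inj₂ i)))
    ∏-part S T κ = trans (sum-cong-≗ (λ i → η (splitAt h i))) (∏-++ h _ _)
      where
      η : ∀ x → proj₂ (part (S , T) κ x) ≡
        [ (λ i → proj₂ (part (S , T) κ (inj₁ i))) , (λ i → proj₂ (part (S , T) κ (inj₂ i))) ]′ x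
      η (inj₁ _) = refl
      η (inj₂ _) = refl

    ∏-label : ∀ S T → total S ≡ total T → ∀ κ → ∏ (proj₂ ∘ label (S , T) κ) ≡ ε
    ∏-label S T eq false = begin
      ∏ (proj₂ ∘ label (S , T) false) ≡⟨ ∏-part S T false ⟩
      total S ∙ ∏ (λ i → el (inside T i) ⁻¹) ≡⟨ cong₂ _∙_ eq (∏-⁻¹ (el ∘ inside T)) ⟩
      total T ∙ total T ⁻¹ ≡⟨ inverseʳ _ ⟩
      ε ∎
      where open ≡-Reasoning
    ∏-label S T eq true = begin
      ∏ (proj₂ ∘ label (S , T) true) ≡⟨ ∏-part S T true ⟩
      S′ ∙ ∏ (λ i → el (outside T i) ⁻¹) ≡⟨ cong₂ _∙_ S′≡T′ (∏-⁻¹ (el ∘ outside T)) ⟩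
      T′ ∙ T′ ⁻¹ ≡⟨ inverseʳ _ ⟩
      ε ∎
      where
      open ≡-Reasoning
      S′ = ∏ (el ∘ outside S)
      T′ = ∏ (el ∘ outside T)
      -- A subset and its complement together multiply to the product of the whole group, so equal
      -- products inside give equal products outside.
      S′≡T′ : S′ ≡ T′
      S′≡T′ = ∙-cancelˡ (total S) _ _ (begin
        total S ∙ S′ ≡⟨ ∏-inside-outside S el ⟩
        ∏ el           ≡⟨ ∏-inside-outside T el ⟨
        total T ∙ T′ ≡⟨ cong (_∙ T′) eq ⟨
        total S ∙ T′ ∎)

    module _ (ps : List (Half × Half)) (unique : Unique ps)
             (balanced : All (λ (S , T) → total S ≡ total T) ps) where

      arrangement : ∀ i κ → Σ[ c ∈ (Fin (h + h) ↔ Carrier) ] Σ[ b ∈ (Fin (h + h) ↔ Carrier) ]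
        (∀ p → to b p ≡ to c p ∙ proj₂ (label (lookup ps i) κ p))
      arrangement i κ = hall _ e (∏-label _ _ (All.lookup balanced (∈-lookup i)) κ)

      position : Fin (length ps) → Bool → Carrier → Fin (h + h)
      position i κ = from (proj₁ (arrangement i κ))

      translation : Carrier × Carrier → Bool → Carrier
      translation (t , u) false = t
      translation (t , u) true  = u

      position-injective : ∀ i κ {a b} → position i κ a ≡ position i κ b → a ≡ b
      position-injective i κ = to-injective (↔-sym (proj₁ (arrangement i κ)))

      -- The base `a` goes to the position where `c` takes the value `a ∙ t`. If `d` is the label
      -- there, `b` takes the value `a ∙ d ∙ t`, so `a ∙ d` is injective in `a` because `b` is
      -- injective.
      place : Fin (length ps) × (Carrier × Carrier) → Bool × Carrier → Bool × Carrier
      place (i , tu) (κ , a) = label (lookup ps i) κ (position i κ (a ∙ translation tu κ))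

      place-∙-injective : ∀ i κ {a b} → a ∙ proj₂ (place i (κ , a)) ≡ b ∙ proj₂ (place i (κ , b)) → a ≡ b
      place-∙-injective (i , tu) κ {a} {b} p =
        ∙-cancelʳ t _ _ (position-injective i κ (to-injective (proj₁ (proj₂ arr))
          (trans (image a) (trans (cong (_∙ t) p) (sym (image b))))))
        where
        open ≡-Reasoning
        t = translation tu κ
        arr = arrangement i κ
        image : ∀ a → to (proj₁ (proj₂ arr)) (position i κ (a ∙ t)) ≡ a ∙ proj₂ (place (i , tu) (κ , a)) ∙ t
        image a = begin
          to (proj₁ (proj₂ arr)) q ≡⟨ proj₂ (proj₂ arr) q ⟩
          to (proj₁ arr) q ∙ d     ≡⟨ cong (_∙ d) (Inverse.strictlyInverseˡ (proj₁ arr) (a ∙ t)) ⟩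
          a ∙ t ∙ d                ≡⟨ assoc _ _ _ ⟩
          a ∙ (t ∙ d)              ≡⟨ cong (a ∙_) (comm t d) ⟩
          a ∙ (d ∙ t)              ≡⟨ assoc _ _ _ ⟨
          a ∙ d ∙ t                ∎
          where
          q = position i κ (a ∙ t)
          d = proj₂ (label (lookup ps i) κ q)

      place-injective : ∀ i {x y} → place i x ≡ place i y → x ≡ y
      place-injective (i , tu) {κ , a} {κ′ , b} p
        with label-injective (lookup ps i) {κ} {κ′} p
      ... | q with cong proj₁ q
      ...   | refl = cong (κ ,_) (∙-cancelʳ (translation tu κ) _ _
                (position-injective i κ (cong proj₂ q)))

      -- A translation does not change the set of values taken on a copy, so these sets reveal the
      -- pair of subsets. The arrangement was chosen once for each pair and copy, hence the value at
      -- `ε` reveals the translation.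
      place-faithful : ∀ {i j} → (∀ x → place i x ≡ place j x) → i ≡ j
      place-faithful {i , tu} {j , tu′} p
        with lookup-injective unique (part-faithful (lookup ps i) (lookup ps j) covered)
        where
        covered : ∀ κ k → ∃[ l ] part (lookup ps i) κ k ≡ part (lookup ps j) κ l
        covered κ k = _ , trans (cong (part (lookup ps i) κ) (sym at-k)) (p (κ , a))
          where
          c = proj₁ (arrangement i κ)
          t = translation tu κ
          k′ = Fin.join h h k
          a = to c k′ ∙ t ⁻¹
          at-k : splitAt h (position i κ (a ∙ t)) ≡ k
          at-k = begin
            splitAt h (position i κ (to c k′ ∙ t ⁻¹ ∙ t))   ≡⟨ cong (splitAt h ∘ position i κ) (assoc _ _ _) ⟩
            splitAt h (position i κ (to c k′ ∙ (t ⁻¹ ∙ t))) ≡⟨ cong (λ x → splitAt h (position i κ (to c k′ ∙ x))) (inverseˡ t) ⟩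
            splitAt h (position i κ (to c k′ ∙ ε))          ≡⟨ cong (splitAt h ∘ position i κ) (identityʳ _) ⟩
            splitAt h (position i κ (to c k′))              ≡⟨ cong (splitAt h) (Inverse.strictlyInverseʳ c k′) ⟩
            splitAt h k′                                    ≡⟨ Finₚ.splitAt-join h h k ⟩
            k                                               ∎
            where open ≡-Reasoning
      ... | refl = cong (i ,_) (cong₂ _,_ (same false) (same true))
        where
        same : ∀ κ → translation tu κ ≡ translation tu′ κ
        same κ = ∙-cancelˡ ε _ _ (position-injective i κ
          (cong proj₂ (label-injective (lookup ps i) {κ} {κ} (p (κ , ε)))))

      halvesFamily : Family _∙_ (Fin (length ps) × (Carrier × Carrier))
      halvesFamily = record
        { s = place ; injective = place-injective
        ; ∙-injective = place-∙-injective ; faithful = place-faithful }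

  groupFamily : ∀ h → size ≡ suc h + suc h →
    ∃[ c ] Family _∙_ (Fin c) × 16 ^ size ≤ c ^ 2 * size ^ 2
  groupFamily h size≡ = c , reindex index index-injective F , bound
    where
    N = suc h + suc h
    e : Fin N ↔ Carrier
    e = subst (λ n → Fin n ↔ Carrier) size≡ enum
    open Halves (suc h) e
    colour : Half → ℕ
    colour S = toℕ (from e (total S))
    Hs = subsets N (suc h) (suc h)
    pairs = fibrePairs colour N Hs (subsets-unique N _ _) (All.tabulate λ _ → Finₚ.toℕ<n _)
    ps = proj₁ pairs
    P = length ps
    F = halvesFamily ps (proj₁ (proj₂ pairs))
      (All.map (λ q → to-injective (↔-sym e) (Finₚ.toℕ-injective (proj₂ q))) (proj₁ (proj₂ (proj₂ pairs))))
    c = P * (N * N)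
    index : Fin c → Fin P × (Carrier × Carrier)
    index = map₂ (Product.map (to e) (to e) ∘ remQuot {N} N) ∘ remQuot {P} (N * N)
    index-injective : ∀ {i j} → index i ≡ index j → i ≡ j
    index-injective q = remQuot-injective P (N * N) (cong₂ _,_ (cong proj₁ q)
      (remQuot-injective N N (cong₂ _,_ (to-injective e (cong (proj₁ ∘ proj₂) q))
                                        (to-injective e (cong (proj₂ ∘ proj₂) q)))))
    B = centralBinomial (suc h)
    -- Without the squares this reads 4^N ≤ N² B² ≤ N² (N P) = c N: first the estimate of the
    -- central binomial coefficient, then Cauchy-Schwarz over the `N` possible products.
    bound : 16 ^ size ≤ c ^ 2 * size ^ 2
    bound = begin
      16 ^ size               ≡⟨ cong (16 ^_) size≡ ⟩
      16 ^ N                  ≡⟨ ^-*-assoc 4 2 N ⟩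
      4 ^ (2 * N)             ≡⟨ cong (4 ^_) (ring₀ (suc h)) ⟩
      4 ^ (suc h * 4)         ≡⟨ ^-*-assoc 4 (suc h) 4 ⟨
      (4 ^ suc h) ^ 4         ≤⟨ ^-monoˡ-≤ 4 (4^h≤2h*centralBinomial h) ⟩
      (N * B) ^ 4             ≡⟨ ring₁ N B ⟩
      (N * N * (B * B)) ^ 2   ≤⟨ ^-monoˡ-≤ 2 (*-monoʳ-≤ (N * N) (proj₂ (proj₂ (proj₂ pairs)))) ⟩
      (N * N * (N * P)) ^ 2   ≡⟨ ring₂ N P ⟩
      c ^ 2 * N ^ 2           ≡⟨ cong (λ n → c ^ 2 * n ^ 2) size≡ ⟨
      c ^ 2 * size ^ 2        ∎
      where
      open ≤-Reasoning
      ring₀ : ∀ h → 2 * (h + h) ≡ h * 4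
      ring₀ = solve-∀
      ring₁ : ∀ N B → N * B * (N * B * (N * B * (N * B * 1))) ≡ N * N * (B * B) * (N * N * (B * B) * 1)
      ring₁ = solve-∀
      ring₂ : ∀ N P → N * N * (N * P) * (N * N * (N * P) * 1) ≡ P * (N * N) * (P * (N * N) * 1) * (N * (N * 1))
      ring₂ = solve-∀

-- Residues modulo distinct primes

Fin-injective⇒surjective : ∀ {n} (f : Fin n → Fin n) → (∀ {i j} → f i ≡ f j → i ≡ j) →
  ∀ y → ∃[ x ] f x ≡ y
Fin-injective⇒surjective {suc n} f f-inj y with Finₚ.any? (λ x → f x Finₚ.≟ y)
... | yes found = found
... | no avoid = contradiction
        (Finₚ.injective⇒≤ {f = λ x → punchOut (y≢ x)} (λ {i} {j} p → f-inj (Finₚ.punchOut-injective (y≢ i) (y≢ j) p)))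
        1+n≰n
  where
  y≢ : ∀ x → y ≢ f x
  y≢ x p = avoid (x , sym p)

injective⇒↔ : ∀ {n} {A B : Set} → Fin n ↔ A → Fin n ↔ B → (f : A → B) →
  (∀ {x y} → f x ≡ f y → x ≡ y) → A ↔ B
injective⇒↔ {n} {A} {B} α β f f-inj =
  mk↔ₛ′ f (proj₁ ∘ preimage) (proj₂ ∘ preimage) (λ x → f-inj (proj₂ (preimage (f x))))
  where
  open Inverse
  preimage : ∀ y → ∃[ x ] f x ≡ y
  preimage y with Fin-injective⇒surjective (from β ∘ f ∘ to α)
                    (to-injective α ∘ f-inj ∘ to-injective (↔-sym β)) (from β y)
  ... | i , p = to α i , to-injective (↔-sym β) p

-- Both parts are closed under the product and every member maps each part to itself. Hence
-- `b ∙ s b` stays in the part of `b`, and injectivity need only be tested within a part.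
sumFamily : {A₁ A₂ B I J : Set} {_∙₁_ : A₁ → A₁ → A₁} {_∙₂_ : A₂ → A₂ → A₂} {_∙_ : B → B → B}
  (φ₁ : A₁ → B) (φ₂ : A₂ → B) (split : B → A₁ ⊎ A₂) →
  (∀ a → split (φ₁ a) ≡ inj₁ a) → (∀ a → split (φ₂ a) ≡ inj₂ a) →
  (∀ b → [ φ₁ , φ₂ ]′ (split b) ≡ b) →
  (∀ a a′ → φ₁ a ∙ φ₁ a′ ≡ φ₁ (a ∙₁ a′)) → (∀ a a′ → φ₂ a ∙ φ₂ a′ ≡ φ₂ (a ∙₂ a′)) →
  Family _∙₁_ I → Family _∙₂_ J → Family _∙_ (I × J)
sumFamily {A₁} {A₂} {B} {I} {J} {_∙₁_} {_∙₂_} {_∙_} φ₁ φ₂ split split-φ₁ split-φ₂ φ-split hom₁ hom₂ F₁ F₂ = record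
  { s = λ ij (κ , b) → s⊎ ij κ (split b)
  ; injective = λ (i , j) {(κ , x)} {(λ′ , y)} p → inj i j (view x) (view y) p
  ; ∙-injective = λ (i , j) κ {a} {b} → ∙-inj i j κ (view a) (view b)
  ; faithful = λ p → cong₂ _,_
      (F.faithful λ (κ , a) → map₂-injective φ₁-injective
        (trans (sym (cong (s⊎ _ κ) (split-φ₁ a))) (trans (p (κ , φ₁ a)) (cong (s⊎ _ κ) (split-φ₁ a)))))
      (G.faithful λ (κ , a) → map₂-injective φ₂-injective
        (trans (sym (cong (s⊎ _ κ) (split-φ₂ a))) (trans (p (κ , φ₂ a)) (cong (s⊎ _ κ) (split-φ₂ a)))))
  }
  where
  module F = Family F₁
  module G = Family F₂
  s⊎ : I × J → Bool → A₁ ⊎ A₂ → Bool × B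
  s⊎ (i , j) κ (inj₁ a) = map₂ φ₁ (F.s i (κ , a))
  s⊎ (i , j) κ (inj₂ a) = map₂ φ₂ (G.s j (κ , a))

  φ₁-injective : ∀ {a b} → φ₁ a ≡ φ₁ b → a ≡ b
  φ₁-injective p = inj₁-injective (trans (sym (split-φ₁ _)) (trans (cong split p) (split-φ₁ _)))
  φ₂-injective : ∀ {a b} → φ₂ a ≡ φ₂ b → a ≡ b
  φ₂-injective p = inj₂-injective (trans (sym (split-φ₂ _)) (trans (cong split p) (split-φ₂ _)))
  disjoint : ∀ {a b} → φ₁ a ≢ φ₂ b
  disjoint p with trans (sym (split-φ₁ _)) (trans (cong split p) (split-φ₂ _))
  ... | ()
  map₂-injective : {X Y : Set} {f : X → Y} → (∀ {a b} → f a ≡ f b → a ≡ b) →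
    {x y : Bool × X} → map₂ f x ≡ map₂ f y → x ≡ y
  map₂-injective f-inj p = cong₂ _,_ (cong proj₁ p) (f-inj (cong proj₂ p))

  data View : B → Set where
    left  : ∀ a → View (φ₁ a)
    right : ∀ a → View (φ₂ a)
  view : ∀ b → View b
  view b with split b | φ-split b
  ... | inj₁ a | refl = left a
  ... | inj₂ a | refl = right a

  inj : ∀ i j {x y κ μ} → View x → View y → s⊎ (i , j) κ (split x) ≡ s⊎ (i , j) μ (split y) → (κ , x) ≡ (μ , y)
  inj i j (left a) (left b) p rewrite split-φ₁ a | split-φ₁ b =
    cong (map₂ φ₁) (F.injective i (map₂-injective φ₁-injective p))
  inj i j (left a) (right b) p rewrite split-φ₁ a | split-φ₂ b = contradiction (cong proj₂ p) disjoint
  inj i j (right a) (left b) p rewrite split-φ₂ a | split-φ₁ b = contradiction (sym (cong proj₂ p)) disjoint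
  inj i j (right a) (right b) p rewrite split-φ₂ a | split-φ₂ b =
    cong (map₂ φ₂) (G.injective j (map₂-injective φ₂-injective p))

  ∙-inj : ∀ i j κ {x y} → View x → View y →
    x ∙ proj₂ (s⊎ (i , j) κ (split x)) ≡ y ∙ proj₂ (s⊎ (i , j) κ (split y)) → x ≡ y
  ∙-inj i j κ (left a) (left b) p rewrite split-φ₁ a | split-φ₁ b =
    cong φ₁ (F.∙-injective i κ (φ₁-injective (trans (sym (hom₁ _ _)) (trans p (hom₁ _ _)))))
  ∙-inj i j κ (left a) (right b) p rewrite split-φ₁ a | split-φ₂ b =
    contradiction (trans (sym (hom₁ _ _)) (trans p (hom₂ _ _))) disjoint
  ∙-inj i j κ (right a) (left b) p rewrite split-φ₂ a | split-φ₁ b =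
    contradiction (sym (trans (sym (hom₂ _ _)) (trans p (hom₁ _ _)))) disjoint
  ∙-inj i j κ (right a) (right b) p rewrite split-φ₂ a | split-φ₂ b =
    cong φ₂ (G.∙-injective j κ (φ₂-injective (trans (sym (hom₂ _ _)) (trans p (hom₂ _ _)))))

transportFamily : {A B I : Set} {_∙_ : A → A → A} {_∘′_ : B → B → B} (f : B ↔ A) →
  (∀ a b → Inverse.to f (a ∘′ b) ≡ Inverse.to f a ∙ Inverse.to f b) →
  Family _∙_ I → Family _∘′_ I
transportFamily {_∙_ = _∙_} f hom F = record
  { s = λ i (κ , b) → map₂ from (s i (κ , to b))
  ; injective = λ i p → inj (injective i (map₂-injective p))
  ; ∙-injective = λ i κ {a} {b} p → to-injective f (∙-injective i κ
      (trans (sym (pull i κ a)) (trans (cong to p) (pull i κ b))))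
  ; faithful = λ {i} {j} p → faithful λ (κ , a) →
      subst (λ x → s i (κ , x) ≡ s j (κ , x)) (strictlyInverseˡ a) (map₂-injective (p (κ , from a)))
  }
  where
  open Inverse f
  open Family F
  map₂-injective : {x y : Bool × _} → map₂ from x ≡ map₂ from y → x ≡ y
  map₂-injective p = cong₂ _,_ (cong proj₁ p) (to-injective (↔-sym f) (cong proj₂ p))
  inj : ∀ {κ μ x y} → (κ , to x) ≡ (μ , to y) → (κ , x) ≡ (μ , y)
  inj p = cong₂ _,_ (cong proj₁ p) (to-injective f (cong proj₂ p))
  pull : ∀ i κ a → to (_ ) ≡ to a ∙ proj₂ (s i (κ , to a))
  pull i κ a = trans (hom a _) (cong (to a ∙_) (strictlyInverseˡ _))

_⊗_ : FinGroup → FinGroup → FinGroup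
G ⊗ H = record
  { Carrier = G.Carrier × H.Carrier
  ; _∙_ = λ (a , x) (b , y) → a G.∙ b , x H.∙ y
  ; ε = G.ε , H.ε
  ; _⁻¹ = λ (a , x) → a G.⁻¹ , x H.⁻¹
  ; isAbelianGroup = record
    { isGroup = record
      { isMonoid = record
        { isSemigroup = record
          { isMagma = record { isEquivalence = isEquivalence ; ∙-cong = cong₂ _ }
          ; assoc = λ _ _ _ → cong₂ _,_ (G.assoc _ _ _) (H.assoc _ _ _) }
        ; identity = (λ _ → cong₂ _,_ (G.identityˡ _) (H.identityˡ _))
                   , (λ _ → cong₂ _,_ (G.identityʳ _) (H.identityʳ _)) }
      ; inverse = (λ _ → cong₂ _,_ (G.inverseˡ _) (H.inverseˡ _))
                , (λ _ → cong₂ _,_ (G.inverseʳ _) (H.inverseʳ _))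
      ; ⁻¹-cong = cong λ (a , x) → a G.⁻¹ , x H.⁻¹ }
    ; comm = λ _ _ → cong₂ _,_ (G.comm _ _) (H.comm _ _) }
  ; size = G.size * H.size
  ; enum = (G.enum ×-↔ H.enum) ↔-∘ Finₚ.*↔×
  }
  where
  module G = FinGroup G
  module H = FinGroup H

%≡⇒∣∣-∣ : ∀ m n d .{{_ : NonZero d}} → m % d ≡ n % d → d ∣ ∣ m - n ∣
%≡⇒∣∣-∣ m n d eq = [ up m n eq , (λ n≤m → subst (d ∣_) (∣-∣-comm n m) (up n m (sym eq) n≤m)) ]′ (≤-total m n)
  where
  open ≡-Reasoning
  up : ∀ m n → m % d ≡ n % d → m ≤ n → d ∣ ∣ m - n ∣
  up m n eq m≤n with m≤n⇒∃[o]m+o≡n m≤n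
  ... | o , refl = subst (d ∣_) (sym (∣m-m+n∣≡n m o))
    (∣m+n∣m⇒∣n (divides ((m + o) / d) (+-cancelˡ-≡ (m % d) _ _ (begin
      m % d + (m / d * d + o)             ≡⟨ +-assoc (m % d) _ o ⟨
      m % d + m / d * d + o               ≡⟨ cong (_+ o) (m≡m%n+[m/n]*n m d) ⟨
      m + o                               ≡⟨ m≡m%n+[m/n]*n (m + o) d ⟩
      (m + o) % d + (m + o) / d * d       ≡⟨ cong (_+ (m + o) / d * d) eq ⟨
      m % d + (m + o) / d * d             ∎))) (n∣m*n (m / d)))

%-absorbˡ : ∀ m n d .{{_ : NonZero d}} → (m % d * n) % d ≡ (m * n) % d
%-absorbˡ m n d = begin
  (m % d * n) % d             ≡⟨ %-distribˡ-* (m % d) n d ⟩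
  (m % d % d * (n % d)) % d   ≡⟨ cong (λ x → (x * (n % d)) % d) (m%n%n≡m%n m d) ⟩
  (m % d * (n % d)) % d       ≡⟨ %-distribˡ-* m n d ⟨
  (m * n) % d                 ∎
  where open ≡-Reasoning

%-absorbʳ : ∀ m n d .{{_ : NonZero d}} → (m * (n % d)) % d ≡ (m * n) % d
%-absorbʳ m n d = trans (cong (_% d) (*-comm m (n % d))) (trans (%-absorbˡ n m d) (cong (_% d) (*-comm n m)))

infixl 7 _·_
_·_ : ∀ {q} → Fin q → Fin q → Fin q
_·_ {suc n} i j = (toℕ i * toℕ j) mod suc n

toℕ-mod : ∀ m n → toℕ (m mod suc n) ≡ m % suc n
toℕ-mod m n = Finₚ.toℕ-fromℕ< (m%n<n m (suc n))

small∣⇒≡0 : ∀ {q d} → q ∣ d → d < q → d ≡ 0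
small∣⇒≡0 {d = zero}  _   _   = refl
small∣⇒≡0 {d = suc d} q∣d d<q = contradiction q∣d (>⇒∤ d<q)

module Units (n : ℕ) (isPrime : Prime (2 + n)) where
  q : ℕ
  q = 2 + n

  -- `u` stands for the residue `suc u`; accordingly `punchOut` at zero, used in `mul`, lowers a
  -- nonzero residue by one.
  Unit : Set
  Unit = Fin (suc n)

  nonzero : ∀ (u v : Unit) → zero ≢ suc u · suc v
  nonzero u v p with euclidsLemma (suc (toℕ u)) (suc (toℕ v)) isPrime
    (subst (q ∣_) (∣-∣-identityʳ _) (%≡⇒∣∣-∣ (suc (toℕ u) * suc (toℕ v)) 0 q
      (trans (sym (toℕ-mod (suc (toℕ u) * suc (toℕ v)) (suc n))) (cong toℕ (sym p)))))
  ... | inj₁ q∣ = contradiction (small∣⇒≡0 q∣ (s≤s (Finₚ.toℕ<n u))) λ ()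
  ... | inj₂ q∣ = contradiction (small∣⇒≡0 q∣ (s≤s (Finₚ.toℕ<n v))) λ ()

  mul : Unit → Unit → Unit
  mul u v = punchOut (nonzero u v)

  suc-mul : ∀ u v → suc (mul u v) ≡ suc u · suc v
  suc-mul u v = Finₚ.punchIn-punchOut (nonzero u v)

  val : Unit → ℕ
  val u = suc (toℕ u)

  val-injective : ∀ {u v} → val u ≡ val v → u ≡ v
  val-injective = Finₚ.toℕ-injective ∘ suc-injective

  val<q : ∀ u → val u < q
  val<q u = s≤s (Finₚ.toℕ<n u)

  val-mul : ∀ u v → val (mul u v) ≡ (val u * val v) % q
  val-mul u v = trans (cong toℕ (suc-mul u v)) (toℕ-mod (val u * val v) (suc n))

  mul-comm : ∀ u v → mul u v ≡ mul v u
  mul-comm u v = val-injective (trans (val-mul u v)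
    (trans (cong (_% q) (*-comm (val u) (val v))) (sym (val-mul v u))))

  mul-assoc : ∀ u v w → mul (mul u v) w ≡ mul u (mul v w)
  mul-assoc u v w = val-injective (begin
    val (mul (mul u v) w)             ≡⟨ val-mul (mul u v) w ⟩
    (val (mul u v) * val w) % q       ≡⟨ cong (λ x → (x * val w) % q) (val-mul u v) ⟩
    ((val u * val v) % q * val w) % q ≡⟨ %-absorbˡ (val u * val v) (val w) q ⟩
    (val u * val v * val w) % q       ≡⟨ cong (_% q) (*-assoc (val u) (val v) (val w)) ⟩
    (val u * (val v * val w)) % q     ≡⟨ %-absorbʳ (val u) (val v * val w) q ⟨
    (val u * ((val v * val w) % q)) % q ≡⟨ cong (λ x → (val u * x) % q) (val-mul v w) ⟨
    (val u * val (mul v w)) % q       ≡⟨ val-mul u (mul v w) ⟨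
    val (mul u (mul v w))             ∎)
    where open ≡-Reasoning

  mul-identityˡ : ∀ u → mul zero u ≡ u
  mul-identityˡ u = val-injective (trans (val-mul zero u)
    (trans (cong (_% q) (*-identityˡ (val u))) (m<n⇒m%n≡m (val<q u))))

  mul-cancelˡ : ∀ u {v w} → mul u v ≡ mul u w → v ≡ w
  mul-cancelˡ u {v} {w} p with euclidsLemma (val u) ∣ val v - val w ∣ isPrime
    (subst (q ∣_) (sym (*-distribˡ-∣-∣ (val u) (val v) (val w)))
      (%≡⇒∣∣-∣ (val u * val v) (val u * val w) q
        (trans (sym (val-mul u v)) (trans (cong val p) (val-mul u w)))))
  ... | inj₁ q∣ = contradiction (small∣⇒≡0 q∣ (val<q u)) λ ()
  ... | inj₂ q∣ = val-injective (∣m-n∣≡0⇒m≡n (small∣⇒≡0 q∣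
        (≤-<-trans (∣m-n∣≤m⊔n (val v) (val w)) (⊔-lub (val<q v) (val<q w)))))

  -- Multiplication by `u` is cancellative on a finite set, hence onto.
  inverse : ∀ u → ∃[ v ] mul u v ≡ zero
  inverse u = Fin-injective⇒surjective (mul u) (mul-cancelˡ u) zero

  units : FinGroup
  units = record
    { Carrier = Unit
    ; _∙_ = mul
    ; ε = zero
    ; _⁻¹ = proj₁ ∘ inverse
    ; isAbelianGroup = record
      { isGroup = record
        { isMonoid = record
          { isSemigroup = record
            { isMagma = record { isEquivalence = isEquivalence ; ∙-cong = cong₂ mul }
            ; assoc = mul-assoc }
          ; identity = mul-identityˡ , λ u → trans (mul-comm u zero) (mul-identityˡ u) }
        ; inverse = (λ u → trans (mul-comm (proj₁ (inverse u)) u) (proj₂ (inverse u))) , proj₂ ∘ inverse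
        ; ⁻¹-cong = cong (proj₁ ∘ inverse) }
      ; comm = mul-comm }
    ; size = suc n
    ; enum = ↔-id _
    }

Residues : List ℕ → Set
Residues []       = ⊤
Residues (q ∷ qs) = Fin q × Residues qs

infixl 7 _⊛_
_⊛_ : ∀ {qs} → Residues qs → Residues qs → Residues qs
_⊛_ {[]}     _       _       = tt
_⊛_ {q ∷ qs} (i , x) (j , y) = i · j , x ⊛ y

-- `G` collects the unit groups of the primes already split; `qs` lists the fields that remain to be
-- split.
mul× : (G : FinGroup) (qs : List ℕ) → let open FinGroup G in
  Carrier × Residues qs → Carrier × Residues qs → Carrier × Residues qs
mul× G qs (g , x) (h , y) = FinGroup._∙_ G g h , x ⊛ y

liftFamily : ∀ {I} (G : FinGroup) → Family (FinGroup._∙_ G) I → Family (mul× G []) I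
liftFamily G = transportFamily (mk↔ₛ′ proj₁ (_, tt) (λ _ → refl) (λ _ → refl)) (λ _ _ → refl)

-- 𝔽_q splits multiplicatively into 0 and 𝔽_q^×.
splitFamily : ∀ {I J} (G : FinGroup) n (isPrime : Prime (2 + n)) qs →
  Family (mul× G qs) I → Family (mul× (G ⊗ Units.units n isPrime) qs) J →
  Family (mul× G (2 + n ∷ qs)) (I × J)
splitFamily G n isPrime qs = sumFamily
  (λ (g , x) → g , zero , x)
  (λ ((g , u) , x) → g , suc u , x)
  (λ { (g , zero , x) → inj₁ (g , x) ; (g , suc u , x) → inj₂ ((g , u) , x) })
  (λ _ → refl) (λ _ → refl)
  (λ { (g , zero , x) → refl ; (g , suc u , x) → refl })
  (λ _ _ → refl)
  (λ ((g , u) , x) ((h , v) , y) → cong (λ w → _ , w , x ⊛ y) (sym (Units.suc-mul n isPrime u v)))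

-- Lower bounds for families

OddPrime : ℕ → Set
OddPrime q = Prime q × ¬ (2 ∣ q)

half : ∀ n → (∃[ h ] n ≡ h + h) ⊎ (∃[ h ] n ≡ suc (h + h))
half zero    = inj₁ (0 , refl)
half (suc n) with half n
... | inj₁ (h , eq) = inj₂ (h , cong suc eq)
... | inj₂ (h , eq) = inj₁ (suc h , cong suc (trans eq (sym (+-suc h h))))

odd⇒even-pred : ∀ n → ¬ (2 ∣ suc (suc n)) → ∃[ h ] suc n ≡ suc h + suc h
odd⇒even-pred n odd with half (suc n)
... | inj₁ (zero , ())
... | inj₁ (suc h , eq) = h , eq
... | inj₂ (h , eq)     = contradiction (divides (suc h) (trans (cong suc eq) (ring h))) odd
  where
  ring : ∀ h → 2 + (h + h) ≡ (1 + h) * 2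
  ring = solve-∀

totient : List ℕ → ℕ
totient qs = product (map pred qs)

combineFamilies : ∀ {c d} (G : FinGroup) n (isPrime : Prime (2 + n)) qs →
  Family (mul× G qs) (Fin c) → Family (mul× (G ⊗ Units.units n isPrime) qs) (Fin d) →
  Family (mul× G (2 + n ∷ qs)) (Fin (c * d))
combineFamilies {c} {d} G n isPrime qs F₁ F₂ =
  reindex (Fin.remQuot {c} d) (remQuot-injective c d) (splitFamily G n isPrime qs F₁ F₂)

^-distribʳ-* : ∀ o m n → (m * n) ^ o ≡ m ^ o * n ^ o
^-distribʳ-* zero    m n = refl
^-distribʳ-* (suc o) m n = trans (cong (m * n *_) (^-distribʳ-* o m n)) (ring m n (m ^ o) (n ^ o))
  where
  ring : ∀ m n a b → m * n * (a * b) ≡ m * a * (n * b)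
  ring = solve-∀

^-double : ∀ a n → a ^ (2 * n) ≡ a ^ n * a ^ n
^-double a n = trans (cong (a ^_) (cong (_+_ n) (+-identityʳ n))) (^-distribˡ-+-* a n n)

evenFamily-step : ∀ N M Q Φ E c d →
  16 ^ (N * Q) ≤ c ^ 2 * (N ^ (2 * E) * Φ ^ E) →
  16 ^ (N * M * Q) ≤ d ^ 2 * ((N * M) ^ (2 * E) * Φ ^ E) →
  16 ^ (N * (suc M * Q)) ≤ (c * d) ^ 2 * (N ^ (2 * (2 * E)) * (M * Φ) ^ (2 * E))
evenFamily-step N M Q Φ E c d bound₁ bound₂ = begin
  16 ^ (N * (suc M * Q))
    ≡⟨ cong (16 ^_) (ring₁ N M Q) ⟩
  16 ^ (N * Q + N * M * Q)
    ≡⟨ ^-distribˡ-+-* 16 (N * Q) (N * M * Q) ⟩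
  16 ^ (N * Q) * 16 ^ (N * M * Q)
    ≤⟨ *-mono-≤ bound₁ bound₂ ⟩
  c ^ 2 * (N ^ (2 * E) * Φ ^ E) * (d ^ 2 * ((N * M) ^ (2 * E) * Φ ^ E))
    ≡⟨ cong (λ x → c ^ 2 * (N ^ (2 * E) * Φ ^ E) * (d ^ 2 * (x * Φ ^ E))) (^-distribʳ-* (2 * E) N M) ⟩
  c ^ 2 * (N ^ (2 * E) * Φ ^ E) * (d ^ 2 * (N ^ (2 * E) * M ^ (2 * E) * Φ ^ E))
    ≡⟨ ring₂ (c ^ 2) (d ^ 2) (N ^ (2 * E)) (M ^ (2 * E)) (Φ ^ E) ⟩
  c ^ 2 * d ^ 2 * (N ^ (2 * E) * N ^ (2 * E) * (M ^ (2 * E) * (Φ ^ E * Φ ^ E)))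
    ≡⟨ cong₂ (λ x y → c ^ 2 * d ^ 2 * (x * (M ^ (2 * E) * y))) (^-double N (2 * E)) (^-double Φ E) ⟨
  c ^ 2 * d ^ 2 * (N ^ (2 * (2 * E)) * (M ^ (2 * E) * Φ ^ (2 * E)))
    ≡⟨ cong₂ (λ x y → x * (N ^ (2 * (2 * E)) * y)) (^-distribʳ-* 2 c d) (^-distribʳ-* (2 * E) M Φ) ⟨
  (c * d) ^ 2 * (N ^ (2 * (2 * E)) * (M * Φ) ^ (2 * E)) ∎
  where
  open ≤-Reasoning
  ring₁ : ∀ N M Q → N * ((1 + M) * Q) ≡ N * Q + N * M * Q
  ring₁ = solve-∀
  ring₂ : ∀ c d a b f → c * (a * f) * (d * (a * b * f)) ≡ c * d * (a * a * (b * (f * f)))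
  ring₂ = solve-∀

trivialFamily-step : ∀ M Q Φ E c d →
  16 ^ Q ≤ 4 * c ^ 2 * Φ ^ E → 16 ^ (M * Q) ≤ d ^ 2 * (M ^ (2 * E) * Φ ^ E) →
  16 ^ (suc M * Q) ≤ 4 * (c * d) ^ 2 * (M * Φ) ^ (2 * E)
trivialFamily-step M Q Φ E c d bound₁ bound₂ = begin
  16 ^ (Q + M * Q)
    ≡⟨ ^-distribˡ-+-* 16 Q (M * Q) ⟩
  16 ^ Q * 16 ^ (M * Q)
    ≤⟨ *-mono-≤ bound₁ bound₂ ⟩
  4 * c ^ 2 * Φ ^ E * (d ^ 2 * (M ^ (2 * E) * Φ ^ E))
    ≡⟨ ring (c ^ 2) (d ^ 2) (M ^ (2 * E)) (Φ ^ E) ⟩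
  4 * (c ^ 2 * d ^ 2) * (M ^ (2 * E) * (Φ ^ E * Φ ^ E))
    ≡⟨ cong (λ x → 4 * (c ^ 2 * d ^ 2) * (M ^ (2 * E) * x)) (^-double Φ E) ⟨
  4 * (c ^ 2 * d ^ 2) * (M ^ (2 * E) * Φ ^ (2 * E))
    ≡⟨ cong₂ (λ x y → 4 * x * y) (^-distribʳ-* 2 c d) (^-distribʳ-* (2 * E) M Φ) ⟨
  4 * (c * d) ^ 2 * (M * Φ) ^ (2 * E) ∎
  where
  open ≤-Reasoning
  ring : ∀ c d b f → 4 * c * f * (d * (b * f)) ≡ 4 * (c * d) * (b * (f * f))
  ring = solve-∀

-- Unfolded, this multiplies the bounds c² N_S² ≥ 16^N_S over all subsets S of `qs`, where N_S is
-- `N` times the product of q - 1 over S. The N_S add up to `N * product qs`; in the product of the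
-- N_S², `N` occurs twice for each of the 2^k subsets, and each q - 1 twice for the half of them
-- containing q.
evenFamily : ∀ qs → All OddPrime qs → ∀ (G : FinGroup) h → let N = FinGroup.size G in N ≡ suc h + suc h →
  ∃[ c ] Family (mul× G qs) (Fin c) ×
    16 ^ (N * product qs) ≤ c ^ 2 * (N ^ (2 ^ suc (length qs)) * totient qs ^ (2 ^ length qs))
evenFamily [] [] G h N≡ = proj₁ base , liftFamily G (proj₁ (proj₂ base)) ,
  subst₂ (λ m x → 16 ^ m ≤ proj₁ base ^ 2 * x) (sym (*-identityʳ N)) (sym (*-identityʳ (N ^ 2)))
    (proj₂ (proj₂ base))
  where
  N = FinGroup.size G
  base = groupFamily G h N≡
evenFamily (0 ∷ qs) ((q , _) ∷ _) = contradiction q ¬prime[0]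
evenFamily (1 ∷ qs) ((q , _) ∷ _) = contradiction q ¬prime[1]
evenFamily (suc (suc n) ∷ qs) ((q , _) ∷ odd) G h N≡ =
  proj₁ F₁ * proj₁ F₂ , combineFamilies G n q qs (proj₁ (proj₂ F₁)) (proj₁ (proj₂ F₂)) ,
  evenFamily-step (FinGroup.size G) (suc n) (product qs) (totient qs) (2 ^ length qs) (proj₁ F₁) (proj₁ F₂)
    (proj₂ (proj₂ F₁)) (proj₂ (proj₂ F₂))
  where
  F₁ = evenFamily qs odd G h N≡
  F₂ = evenFamily qs odd (G ⊗ Units.units n q) (n + h * suc n)
         (trans (cong (_* suc n) N≡) (*-distribʳ-+ (suc n) (suc h) (suc h)))

-- Only the empty subset leaves the trivial group, whose 2 members give 16 = 4 * 2², whence the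
-- factor 4. As soon as one odd q contributes its units, the order is even and `evenFamily` takes
-- over.
trivialFamily : ∀ qs → All OddPrime qs → ∀ (G : FinGroup) → FinGroup.size G ≡ 1 →
  ∃[ c ] Family (mul× G qs) (Fin c) × 16 ^ product qs ≤ 4 * c ^ 2 * totient qs ^ (2 ^ length qs)
trivialFamily [] [] G N≡1 = 2 , liftFamily G (singletonFamily G N≡1) , ≤-refl
trivialFamily (0 ∷ qs) ((q , _) ∷ _) = contradiction q ¬prime[0]
trivialFamily (1 ∷ qs) ((q , _) ∷ _) = contradiction q ¬prime[1]
trivialFamily (suc (suc n) ∷ qs) ((q , q-odd) ∷ odd) G N≡1 =
  proj₁ F₁ * proj₁ F₂ , combineFamilies G n q qs (proj₁ (proj₂ F₁)) (proj₁ (proj₂ F₂)) ,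
  trivialFamily-step (suc n) (product qs) (totient qs) (2 ^ length qs) (proj₁ F₁) (proj₁ F₂)
    (proj₂ (proj₂ F₁))
    (subst (λ m → 16 ^ (m * product qs) ≤ proj₁ F₂ ^ 2 * (m ^ (2 ^ suc (length qs)) * totient qs ^ (2 ^ length qs)))
      N*M≡M (proj₂ (proj₂ F₂)))
  where
  N*M≡M : FinGroup.size G * suc n ≡ suc n
  N*M≡M = trans (cong (_* suc n) N≡1) (*-identityˡ (suc n))
  even = odd⇒even-pred n q-odd
  F₁ = trivialFamily qs odd G N≡1
  F₂ = evenFamily qs odd (G ⊗ Units.units n q) (proj₁ even) (trans N*M≡M (proj₂ even))

-- Primitive roots

-- The monic polynomial with lower coefficients cs, constant term first.
evalMonic : List ℤ → ℤ → ℤ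
evalMonic []       x = 1ℤ
evalMonic (c ∷ cs) x = c ℤ.+ x ℤ.* evalMonic cs x

-- Horner's scheme: the constant term of the quotient is the value at `a` of the polynomial with its
-- lowest coefficient removed.
divideByRoot : ∀ a c cs → ∃[ ds ] length ds ≡ length cs ×
  (∀ x → (x ℤ.- a) ℤ.* evalMonic ds x ≡ evalMonic (c ∷ cs) x ℤ.- evalMonic (c ∷ cs) a)
divideByRoot a c [] = [] , refl , λ x → ring x a c
  where
  ring : ∀ x a c → (x ℤ.- a) ℤ.* 1ℤ ≡ (c ℤ.+ x ℤ.* 1ℤ) ℤ.- (c ℤ.+ a ℤ.* 1ℤ)
  ring = solve-ℤ
divideByRoot a c (d ∷ cs) with divideByRoot a d cs
... | ds , len , eq = evalMonic (d ∷ cs) a ∷ ds , cong suc len , λ x → begin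
  (x ℤ.- a) ℤ.* (A ℤ.+ x ℤ.* evalMonic ds x)
    ≡⟨ ring₁ x a A (evalMonic ds x) ⟩
  x ℤ.* ((x ℤ.- a) ℤ.* evalMonic ds x) ℤ.+ (x ℤ.- a) ℤ.* A
    ≡⟨ cong (λ y → x ℤ.* y ℤ.+ (x ℤ.- a) ℤ.* A) (eq x) ⟩
  x ℤ.* (evalMonic (d ∷ cs) x ℤ.- A) ℤ.+ (x ℤ.- a) ℤ.* A
    ≡⟨ ring₂ x a A (evalMonic (d ∷ cs) x) c ⟩
  (c ℤ.+ x ℤ.* evalMonic (d ∷ cs) x) ℤ.- (c ℤ.+ a ℤ.* A) ∎
  where
  open ≡-Reasoning
  A = evalMonic (d ∷ cs) a
  ring₁ : ∀ x a A e → (x ℤ.- a) ℤ.* (A ℤ.+ x ℤ.* e) ≡ x ℤ.* ((x ℤ.- a) ℤ.* e) ℤ.+ (x ℤ.- a) ℤ.* A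
  ring₁ = solve-ℤ
  ring₂ : ∀ x a A e c → x ℤ.* (e ℤ.- A) ℤ.+ (x ℤ.- a) ℤ.* A ≡ (c ℤ.+ x ℤ.* e) ℤ.- (c ℤ.+ a ℤ.* A)
  ring₂ = solve-ℤ

∣[+m]-[+n]∣ : ∀ m o → ℤ.∣ + m ℤ.- + (m + o) ∣ ≡ o
∣[+m]-[+n]∣ m o = trans (cong ℤ.∣_∣ (ℤₚ.m-n≡m⊖n m (m + o)))
  (trans (ℤₚ.∣⊖∣-≤ (m≤m+n m o)) (m+n∸m≡n m o))

-- Taking the roots to be 1, …, deg + 1 suffices for x ^ r - 1.
tooManyRoots : ∀ {p} → Prime p → ∀ d cs → length cs ≡ d → suc d < p →
  ¬ (∀ x → 0 < x → x ≤ suc d → + p ℤ∣.∣ evalMonic cs (+ x))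
tooManyRoots {p} isPrime zero [] refl 1<p roots =
  contradiction (∣1⇒≡1 (∣⇒∣ᵤ (roots 1 z<s ≤-refl))) λ { refl → <-irrefl refl 1<p }
tooManyRoots {p} isPrime (suc d) (c ∷ cs) eq d<p roots with divideByRoot (+ suc (suc d)) c cs
... | ds , len , factor = tooManyRoots isPrime d ds (trans len (suc-injective eq)) (<-trans (n<1+n _) d<p) roots′
  where
  a = suc (suc d)
  roots′ : ∀ x → 0 < x → x ≤ suc d → + p ℤ∣.∣ evalMonic ds (+ x)
  roots′ x 0<x x≤ with m≤n⇒∃[o]m+o≡n x≤
  ... | o , x+o≡ with euclidsLemma ℤ.∣ + x ℤ.- + a ∣ ℤ.∣ evalMonic ds (+ x) ∣ isPrime
      (subst (p ∣_) (ℤₚ.abs-* (+ x ℤ.- + a) (evalMonic ds (+ x)))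
        (∣⇒∣ᵤ (subst (+ p ℤ∣.∣_) (sym (factor (+ x)))
          (ℤ∣.∣m∣n⇒∣m-n (roots x 0<x (m≤n⇒m≤1+n x≤)) (roots a z<s ≤-refl)))))
  ...   | inj₂ p∣ = ∣ᵤ⇒∣ p∣
  -- The difference of `a` and `x` lies strictly between 0 and `p`, so `p` must divide the cofactor
  -- instead.
  ...   | inj₁ p∣ = contradiction (small∣⇒≡0 (subst (p ∣_) gap p∣) (≤-<-trans so≤a d<p)) λ ()
    where
    x+so≡a : x + suc o ≡ a
    x+so≡a = trans (+-suc x o) (cong suc x+o≡)
    gap : ℤ.∣ + x ℤ.- + a ∣ ≡ suc o
    gap = trans (cong (λ b → ℤ.∣ + x ℤ.- + b ∣) (sym x+so≡a)) (∣[+m]-[+n]∣ x (suc o))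
    so≤a : suc o ≤ a
    so≤a = ≤-trans (m≤n+m (suc o) x) (≤-reflexive x+so≡a)

evalMonic-replicate : ∀ r x → evalMonic (replicate r 0ℤ) (+ x) ≡ + (x ^ r)
evalMonic-replicate zero    x = refl
evalMonic-replicate (suc r) x = trans (ℤₚ.+-identityˡ _)
  (trans (cong (+ x ℤ.*_) (evalMonic-replicate r x)) (sym (ℤₚ.pos-* x (x ^ r))))

p∣x^r-1 : ∀ p r x .{{_ : NonZero p}} → x ^ suc r % p ≡ 1 → + p ℤ∣.∣ evalMonic (-1ℤ ∷ replicate r 0ℤ) (+ x)
p∣x^r-1 p r x eq = ℤ∣.divides (+ (x ^ suc r / p)) (begin
  -1ℤ ℤ.+ + x ℤ.* evalMonic (replicate r 0ℤ) (+ x) ≡⟨ cong (λ y → -1ℤ ℤ.+ + x ℤ.* y) (evalMonic-replicate r x) ⟩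
  -1ℤ ℤ.+ + x ℤ.* + (x ^ r)                        ≡⟨ cong (λ y → -1ℤ ℤ.+ y) (ℤₚ.pos-* x (x ^ r)) ⟨
  -1ℤ ℤ.+ + (x ^ suc r)                            ≡⟨ cong (λ y → -1ℤ ℤ.+ + y) (m≡m%n+[m/n]*n (x ^ suc r) p) ⟩
  -1ℤ ℤ.+ + (x ^ suc r % p + k * p)                ≡⟨ cong (λ y → -1ℤ ℤ.+ + (y + k * p)) eq ⟩
  -1ℤ ℤ.+ + (1 + k * p)                            ≡⟨ cong (λ y → -1ℤ ℤ.+ y) (ℤₚ.pos-+ 1 (k * p)) ⟩
  -1ℤ ℤ.+ (1ℤ ℤ.+ + (k * p))                       ≡⟨ ℤₚ.+-assoc -1ℤ 1ℤ (+ (k * p)) ⟨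
  0ℤ ℤ.+ + (k * p)                                 ≡⟨ ℤₚ.+-identityˡ _ ⟩
  + (k * p)                                        ≡⟨ ℤₚ.pos-* k p ⟩
  + k ℤ.* + p                                      ∎)
  where
  open ≡-Reasoning
  k = x ^ suc r / p

prime∤⇒coprime : ∀ {q n} → Prime q → ¬ (q ∣ n) → Coprime q n
prime∤⇒coprime q-prime q∤n (d∣q , d∣n) with prime⇒irreducible q-prime d∣q
... | inj₁ d≡1  = d≡1
... | inj₂ refl = contradiction d∣n q∤n

prime∤product : ∀ {q qs} → Prime q → All Prime qs → All (q ≢_) qs → ¬ (q ∣ product qs)
prime∤product q-prime [] [] q∣1 = contradiction (subst Prime (∣1⇒≡1 q∣1) q-prime) ¬prime[1]
prime∤product {q} {r ∷ qs} q-prime (r-prime ∷ primes) (q≢r ∷ q≢) q∣ with euclidsLemma r (product qs) q-prime q∣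
... | inj₂ q∣qs = prime∤product q-prime primes q≢ q∣qs
... | inj₁ q∣r with prime⇒irreducible r-prime q∣r
...   | inj₁ refl = contradiction q-prime ¬prime[1]
...   | inj₂ q≡r  = q≢r q≡r

coprime-product : ∀ {q m n} → Coprime q m → q ∣ n → m ∣ n → q * m ∣ n
coprime-product {q} {m} coprime q∣n (divides t refl)
  with coprime-divisor {o = t} coprime (subst (q ∣_) (*-comm t m) q∣n)
... | divides s refl = divides s (*-assoc s q m)

distinctPrimes∣ : ∀ {qs n} → All Prime qs → Unique qs → All (_∣ n) qs → product qs ∣ n
distinctPrimes∣ [] [] [] = 1∣ _
distinctPrimes∣ (q ∷ primes) (q≢ ∷ unique) (q∣ ∷ div) =
  coprime-product (prime∤⇒coprime q (prime∤product q primes q≢)) q∣ (distinctPrimes∣ primes unique div)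

-- `n ⋆ x` is the n-th power of `x`, in the additive notation of multiples.
module Powers (G : FinGroup) where
  open FinGroup G
  open Algebra.Properties.CommutativeMonoid.Mult commutativeMonoid public
    renaming (_×_ to _⋆_; ×-homo-+ to ⋆-homo-+; ×-assocˡ to ⋆-assocˡ; ×-distrib-+ to ⋆-distrib-∙)
    using ()

  ⋆-ε : ∀ n → n ⋆ ε ≡ ε
  ⋆-ε zero    = refl
  ⋆-ε (suc n) = trans (identityˡ _) (⋆-ε n)

  ⋆-multiple : ∀ {x} m n → n ⋆ x ≡ ε → (m * n) ⋆ x ≡ ε
  ⋆-multiple {x} m n p = trans (sym (⋆-assocˡ x m n)) (trans (cong (m ⋆_) p) (⋆-ε m))

  -- Multiplication by `x` permutes the group, so the product of all elements is unchanged when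
  -- every factor is multiplied by `x`.
  size⋆≡ε : ∀ x → size ⋆ x ≡ ε
  size⋆≡ε x = ∙-cancelʳ (∏ (Inverse.to enum)) _ _ (begin
    size ⋆ x ∙ ∏ (Inverse.to enum)                  ≡⟨ cong (_∙ ∏ (Inverse.to enum)) (sum-replicate size) ⟨
    ∏ {size} (λ _ → x) ∙ ∏ (Inverse.to enum)        ≡⟨ ∑-distrib-+ (λ _ → x) (Inverse.to enum) ⟨
    ∏ (λ i → x ∙ Inverse.to enum i)                 ≡⟨ Hall.∏-enum G (shift ↔-∘ enum) enum ⟩
    ∏ (Inverse.to enum)                             ≡⟨ identityˡ _ ⟨
    ε ∙ ∏ (Inverse.to enum)                         ∎)
    where
    open ≡-Reasoning
    shift : Carrier ↔ Carrier
    shift = mk↔ₛ′ (x ∙_) (x ⁻¹ ∙_)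
      (λ y → trans (sym (assoc _ _ _)) (trans (cong (_∙ y) (inverseʳ x)) (identityˡ y)))
      (λ y → trans (sym (assoc _ _ _)) (trans (cong (_∙ y) (inverseˡ x)) (identityˡ y)))

  ⋆-bézout : ∀ {x m n} a b → m ⋆ x ≡ ε → n ⋆ x ≡ ε → 1 + a * m ≡ b * n → x ≡ ε
  ⋆-bézout {x} {m} {n} a b p q eq = begin
    x               ≡⟨ identityʳ x ⟨
    x ∙ ε           ≡⟨ cong (x ∙_) (⋆-multiple a m p) ⟨
    (1 + a * m) ⋆ x ≡⟨ cong (_⋆ x) eq ⟩
    (b * n) ⋆ x     ≡⟨ ⋆-multiple b n q ⟩
    ε               ∎
    where open ≡-Reasoning

  ⋆-coprime : ∀ {x m n} → Coprime m n → m ⋆ x ≡ ε → n ⋆ x ≡ ε → x ≡ ε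
  ⋆-coprime coprime p q with coprime-Bézout coprime
  ... | Bézout.+- a b eq = ⋆-bézout b a q p eq
  ... | Bézout.-+ a b eq = ⋆-bézout a b p q eq

  HasOrder : Carrier → ℕ → Set
  HasOrder g n = n ⋆ g ≡ ε × (∀ j → j ⋆ g ≡ ε → n ∣ j)

  -- Since p - 1 is squarefree, a primitive root is a product of elements of distinct prime orders;
  -- no higher prime powers have to be reached.
  squarefreeOrder : ∀ m → (∀ {r} → Prime r → r ∣ m → ∃[ y ] HasOrder y r) →
    ∀ rs → All Prime rs → Unique rs → product rs ∣ m → ∃[ g ] HasOrder g (product rs)
  squarefreeOrder _ _ [] _ _ _ = ε , identityʳ ε , λ j _ → 1∣ j
  squarefreeOrder m primeOrder (r ∷ rs) (r-prime ∷ primes) (r≢ ∷ unique) rs∣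
    with squarefreeOrder m primeOrder rs primes unique (∣-trans (n∣m*n r) rs∣) | primeOrder r-prime (∣-trans (m∣m*n (product rs)) rs∣)
  ... | g , R⋆g , order-g | y , r⋆y , order-y = y ∙ g , kills , order
    where
    open ≡-Reasoning
    R = product rs
    coprime = prime∤⇒coprime r-prime (prime∤product r-prime primes r≢)
    kills : (r * R) ⋆ (y ∙ g) ≡ ε
    kills = begin
      (r * R) ⋆ (y ∙ g)         ≡⟨ ⋆-distrib-∙ y g (r * R) ⟩
      (r * R) ⋆ y ∙ (r * R) ⋆ g ≡⟨ cong₂ _∙_ (trans (cong (_⋆ y) (*-comm r R)) (⋆-multiple R r r⋆y)) (⋆-multiple r R R⋆g) ⟩
      ε ∙ ε                     ≡⟨ identityˡ ε ⟩
      ε                         ∎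
    order : ∀ j → j ⋆ (y ∙ g) ≡ ε → r * R ∣ j
    order j p = coprime-product coprime (order-y j j⋆y) R∣j
      where
      -- Taking r-th powers removes `y`, so the order of `g` divides `r * j`, and being coprime to
      -- `r` it divides `j`.
      rj⋆g : (r * j) ⋆ g ≡ ε
      rj⋆g = begin
        (r * j) ⋆ g               ≡⟨ identityˡ _ ⟨
        ε ∙ (r * j) ⋆ g           ≡⟨ cong (_∙ (r * j) ⋆ g) (trans (cong (_⋆ y) (*-comm r j)) (⋆-multiple j r r⋆y)) ⟨
        (r * j) ⋆ y ∙ (r * j) ⋆ g ≡⟨ ⋆-distrib-∙ y g (r * j) ⟨
        (r * j) ⋆ (y ∙ g)         ≡⟨ ⋆-multiple r j p ⟩
        ε                         ∎
      R∣j : R ∣ j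
      R∣j = coprime-divisor (Coprimality.sym coprime) (order-g (r * j) rj⋆g)
      j⋆g : j ⋆ g ≡ ε
      j⋆g with R∣j
      ... | divides t eq = trans (cong (_⋆ g) eq) (⋆-multiple t R R⋆g)
      j⋆y : j ⋆ y ≡ ε
      j⋆y = begin
        j ⋆ y         ≡⟨ identityʳ _ ⟨
        j ⋆ y ∙ ε     ≡⟨ cong (j ⋆ y ∙_) j⋆g ⟨
        j ⋆ y ∙ j ⋆ g ≡⟨ ⋆-distrib-∙ y g j ⟨
        j ⋆ (y ∙ g)   ≡⟨ p ⟩
        ε             ∎

module _ (n : ℕ) (isPrime : Prime (2 + n)) where
  open Units n isPrime
  open FinGroup units using (_∙_; ε; identityˡ; identityʳ; size)
  open Powers units

  val-⋆ : ∀ k u → val (k ⋆ u) ≡ val u ^ k % q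
  val-⋆ zero    u = refl
  val-⋆ (suc k) u = trans (val-mul u (k ⋆ u))
    (trans (cong (λ x → (val u * x) % q) (val-⋆ k u)) (%-absorbʳ (val u) (val u ^ k) q))

  -- Otherwise x^r - 1 would vanish modulo `q` at 1, ..., r + 1, which are all units because r < q -
  -- 1.
  nontrivialPower : ∀ r → r < suc n → r ≢ 0 → ∃[ u ] r ⋆ u ≢ ε
  nontrivialPower zero    _   0≢0 = contradiction refl 0≢0
  nontrivialPower (suc r) r<m _   = Finₚ.¬∀⟶∃¬ _ _ (λ u → suc r ⋆ u Finₚ.≟ ε) λ all →
    tooManyRoots isPrime (suc r) (-1ℤ ∷ replicate r 0ℤ) (cong suc (length-replicate r)) (s≤s r<m)
      λ where
        (suc x) _ (s≤s x≤) → p∣x^r-1 q r (suc x) (trans (sym (val-fromℕ< x (≤-<-trans x≤ r<m) (suc r)))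
          (cong val (all _)))
    where
    val-fromℕ< : ∀ x (x< : x < suc n) k → val (k ⋆ Fin.fromℕ< x<) ≡ suc x ^ k % q
    val-fromℕ< x x< k = trans (val-⋆ k _) (cong (λ y → suc y ^ k % q) (Finₚ.toℕ-fromℕ< x<))

  -- With p - 1 = t r, choose a unit `x` whose t-th power is not 1 and take that power. Its r-th
  -- power is 1, and a further exponent prime to `r` killing it would make it trivial.
  primeOrder : ∀ {r} → Prime r → r ∣ suc n → ∃[ y ] HasOrder y r
  primeOrder {r} r-prime (divides t eq) = t ⋆ x , r⋆y , order
    where
    t≢0 : t ≢ 0
    t≢0 refl = contradiction eq λ ()
    t<m : t < suc n
    t<m = subst (t <_) (sym eq) (strict t r r-prime t≢0)
      where
      strict : ∀ t r → Prime r → t ≢ 0 → t < t * r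
      strict zero    _ _ t≢0 = contradiction refl t≢0
      strict (suc t) 0 r-prime _ = contradiction r-prime ¬prime[0]
      strict (suc t) 1 r-prime _ = contradiction r-prime ¬prime[1]
      strict (suc t) (suc (suc r)) _ _ = m<m*n (suc t) (2 + r) (s≤s z<s)
    x = proj₁ (nontrivialPower t t<m t≢0)
    r⋆y : r ⋆ (t ⋆ x) ≡ ε
    r⋆y = trans (⋆-assocˡ x r t) (trans (cong (_⋆ x) (trans (*-comm r t) (sym eq))) (size⋆≡ε x))
    order : ∀ j → j ⋆ (t ⋆ x) ≡ ε → r ∣ j
    order j p with r ∣? j
    ... | yes r∣j = r∣j
    ... | no r∤j  = contradiction (⋆-coprime (prime∤⇒coprime r-prime r∤j) r⋆y p)
                      (proj₂ (nontrivialPower t t<m t≢0))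

  primitiveRoot : ∀ rs → All Prime rs → Unique rs → suc n ≡ product rs → ∃[ g ] HasOrder g (suc n)
  primitiveRoot rs primes unique eq =
    subst (λ m → ∃[ g ] HasOrder g m) (sym eq)
      (squarefreeOrder (suc n) primeOrder rs primes unique (subst (_∣ suc n) eq ∣-refl))

-- The Chinese remainder theorem and bijections of {1,…,N-1}

residue : ∀ {qs} → All Prime qs → ℕ → Residues qs
residue {[]}         []       _ = tt
residue {zero ∷ qs}  (q ∷ _)  _ = contradiction q ¬prime[0]
residue {suc n ∷ qs} (_ ∷ ps) x = x mod suc n , residue ps x

mod-* : ∀ m o n → (m * o) mod suc n ≡ (m mod suc n) · (o mod suc n)
mod-* m o n = Finₚ.toℕ-injective (begin
  toℕ ((m * o) mod suc n)                                ≡⟨ toℕ-mod (m * o) n ⟩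
  (m * o) % suc n                                        ≡⟨ %-distribˡ-* m o (suc n) ⟩
  (m % suc n * (o % suc n)) % suc n                      ≡⟨ cong₂ (λ x y → (x * y) % suc n) (toℕ-mod m n) (toℕ-mod o n) ⟨
  (toℕ (m mod suc n) * toℕ (o mod suc n)) % suc n        ≡⟨ toℕ-mod (toℕ (m mod suc n) * toℕ (o mod suc n)) n ⟨
  toℕ ((m mod suc n) · (o mod suc n))                    ∎)
  where open ≡-Reasoning

∣∣-∣⇒%≡ : ∀ m n d .{{_ : NonZero d}} → d ∣ ∣ m - n ∣ → m % d ≡ n % d
∣∣-∣⇒%≡ m n d d∣ = [ up m n d∣ , sym ∘ up n m (subst (d ∣_) (∣-∣-comm m n) d∣) ]′ (≤-total m n)
  where
  up : ∀ m n → d ∣ ∣ m - n ∣ → m ≤ n → m % d ≡ n % d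
  up m n d∣ m≤n with m≤n⇒∃[o]m+o≡n m≤n
  ... | o , refl with subst (d ∣_) (∣m-m+n∣≡n m o) d∣
  ...   | divides k refl = sym ([m+kn]%n≡m%n m k d)

residue-* : ∀ {qs} (ps : All Prime qs) m n → residue ps (m * n) ≡ residue ps m ⊛ residue ps n
residue-* {[]}         []       m o = refl
residue-* {zero ∷ qs}  (q ∷ _)  m o = contradiction q ¬prime[0]
residue-* {suc n ∷ qs} (_ ∷ ps) m o = cong₂ _,_ (mod-* m o n) (residue-* ps m o)

residue-cong : ∀ {qs} (ps : All Prime qs) m n → product qs ∣ ∣ m - n ∣ → residue ps m ≡ residue ps n
residue-cong {[]}         []       m o _ = refl
residue-cong {zero ∷ qs}  (q ∷ _)  m o _ = contradiction q ¬prime[0]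
residue-cong {suc n ∷ qs} (_ ∷ ps) m o d∣ = cong₂ _,_
  (Finₚ.toℕ-injective (trans (toℕ-mod m n)
    (trans (∣∣-∣⇒%≡ m o (suc n) (∣-trans (m∣m*n (product qs)) d∣)) (sym (toℕ-mod o n)))))
  (residue-cong ps m o (∣-trans (n∣m*n (suc n)) d∣))

residue-injective : ∀ {qs} (ps : All Prime qs) → Unique qs → ∀ {m n} →
  residue ps m ≡ residue ps n → product qs ∣ ∣ m - n ∣
residue-injective ps unique {m} {n} eq = distinctPrimes∣ ps unique (factors ps eq)
  where
  factors : ∀ {qs} (ps : All Prime qs) → residue ps m ≡ residue ps n → All (_∣ ∣ m - n ∣) qs
  factors {[]}         []       _  = []
  factors {zero ∷ qs}  (q ∷ _)  _  = contradiction q ¬prime[0]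
  factors {suc k ∷ qs} (_ ∷ ps) eq =
    %≡⇒∣∣-∣ m n (suc k) (trans (sym (toℕ-mod m k)) (trans (cong (toℕ ∘ proj₁) eq) (toℕ-mod n k)))
    ∷ factors ps (cong proj₂ eq)

Fin↔Residues : ∀ qs → Fin (product qs) ↔ Residues qs
Fin↔Residues []       = Finₚ.1↔⊤
Fin↔Residues (q ∷ qs) = (↔-id _ ×-↔ Fin↔Residues qs) ↔-∘ Finₚ.*↔×

∣+-+∣ : ∀ o m n → ∣ o + m - o + n ∣ ≡ ∣ m - n ∣
∣+-+∣ zero    m n = refl
∣+-+∣ (suc o) m n = ∣+-+∣ o m n

∣toℕ-toℕ∣<n : ∀ {n} (i j : Fin n) → ∣ toℕ i - toℕ j ∣ < n
∣toℕ-toℕ∣<n i j = ≤-<-trans (∣m-n∣≤m⊔n (toℕ i) (toℕ j)) (⊔-lub (Finₚ.toℕ<n i) (Finₚ.toℕ<n j))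

-- The offset `o` selects which complete system of representatives is used: 1, ..., M for exponents,
-- which must be positive, and 0, ..., N - 1 for bases.
crt : ∀ {qs} (ps : All Prime qs) → Unique qs → ℕ → Fin (product qs) ↔ Residues qs
crt {qs} ps unique o = injective⇒↔ (↔-id _) (Fin↔Residues qs) (λ j → residue ps (o + toℕ j)) λ {i} {j} eq →
  Finₚ.toℕ-injective (∣m-n∣≡0⇒m≡n (small∣⇒≡0
    (subst (product qs ∣_) (∣+-+∣ o (toℕ i) (toℕ j)) (residue-injective ps unique eq))
    (∣toℕ-toℕ∣<n i j)))

-- Surjectivity follows from these two fields by finiteness and is recovered in
-- `bijectiveOn⇒isBijOn`.
record BijectiveOn (N : ℕ) (f : ℕ → ℕ) : Set where
  field
    maps      : ∀ {x} → 0 < x → x < N → 0 < f x × f x < N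
    injective : ∀ {x y} → 0 < x → x < N → 0 < y → y < N → f x ≡ f y → x ≡ y

∈-range⁻ : ∀ {N x} → x ∈ range N → 0 < x × x < N
∈-range⁻ {suc N} x∈ with ∈-map⁻ suc x∈
... | i , i∈ , refl = z<s , s≤s (∈-upTo⁻ i∈)

∈-range⁺ : ∀ {N x} → 0 < x → x < N → x ∈ range N
∈-range⁺ {suc N} {suc x} _ (s≤s x<N) = ∈-map⁺ suc (∈-upTo⁺ x<N)

bijectiveOn⇒isBijOn : ∀ N f → BijectiveOn N f → T (isBijOn N f)
bijectiveOn⇒isBijOn N f bij = from T-∧
  ( Allₚ.all⁻ _ (All.tabulate λ x∈ → let 0<x , x<N = ∈-range⁻ {N} x∈ ; 0<fx , fx<N = maps 0<x x<N in
      from T-∧ (<⇒<ᵇ 0<fx , <⇒<ᵇ fx<N))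
  , from T-∧
    ( Allₚ.all⁻ _ (All.tabulate λ {x} x∈ → Allₚ.all⁻ _ (All.tabulate λ {y} y∈ → one-one x y x∈ y∈))
    , Allₚ.all⁻ _ (All.tabulate λ {y} y∈ → Anyₚ.any⁺ _ (onto y∈))))
  where
  open Equivalence using (from)
  open BijectiveOn bij
  one-one : ∀ x y → x ∈ range N → y ∈ range N → T (not (f x ≡ᵇ f y) ∨ (x ≡ᵇ y))
  one-one x y x∈ y∈ with f x ≡ᵇ f y in eq
  ... | false = tt
  ... | true  = ≡⇒≡ᵇ x y (injective (proj₁ (∈-range⁻ {N} x∈)) (proj₂ (∈-range⁻ {N} x∈))
                  (proj₁ (∈-range⁻ {N} y∈)) (proj₂ (∈-range⁻ {N} y∈)) (≡ᵇ⇒≡ (f x) (f y) (subst T (sym eq) tt)))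

  onto : ∀ {y} → y ∈ range N → Any.Any (λ x → T (f x ≡ᵇ y)) (range N)
  onto {y} y∈ = surj N (λ 0<x x<N → maps 0<x x<N) injective (∈-range⁻ {N} y∈)
    where
    surj : ∀ N → (∀ {x} → 0 < x → x < N → 0 < f x × f x < N) →
      (∀ {x y} → 0 < x → x < N → 0 < y → y < N → f x ≡ f y → x ≡ y) →
      0 < y × y < N → Any.Any (λ x → T (f x ≡ᵇ y)) (range N)
    surj (suc N) maps injective (0<y , s≤s y≤N) = Any.map (λ { refl → ≡⇒≡ᵇ (f x) y fx≡y }) (∈-range⁺ {suc N} {x} z<s (s≤s (Finₚ.toℕ<n i)))
      where
      0<f : ∀ (i : Fin N) → 0 < f (suc (toℕ i))
      0<f i = proj₁ (maps z<s (s≤s (Finₚ.toℕ<n i)))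
      f<N : ∀ (i : Fin N) → f (suc (toℕ i)) ∸ 1 < N
      f<N i = ≤-trans (≤-reflexive (m+[n∸m]≡n (0<f i))) (s≤s⁻¹ (proj₂ (maps z<s (s≤s (Finₚ.toℕ<n i)))))
      f′ : Fin N → Fin N
      f′ i = fromℕ< (f<N i)
      f≡ : ∀ i → f (suc (toℕ i)) ≡ suc (toℕ (f′ i))
      f≡ i = trans (sym (m+[n∸m]≡n (0<f i))) (cong suc (sym (Finₚ.toℕ-fromℕ< (f<N i))))
      y-1<N : y ∸ 1 < N
      y-1<N = ≤-trans (≤-reflexive (m+[n∸m]≡n 0<y)) y≤N
      preimage = Fin-injective⇒surjective f′
        (λ {i} {j} p → Finₚ.toℕ-injective (suc-injective (injective z<s (s≤s (Finₚ.toℕ<n i)) z<s (s≤s (Finₚ.toℕ<n j))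
          (trans (f≡ i) (trans (cong (suc ∘ toℕ) p) (sym (f≡ j)))))))
        (fromℕ< y-1<N)
      i = proj₁ preimage
      x = suc (toℕ i)
      fx≡y : f x ≡ y
      fx≡y = trans (f≡ i) (trans (cong (suc ∘ toℕ) (proj₂ preimage))
        (trans (cong suc (Finₚ.toℕ-fromℕ< y-1<N)) (m+[n∸m]≡n 0<y)))

bijectiveOn-cong : ∀ {N f g} → (∀ {x} → 0 < x → x < N → f x ≡ g x) → BijectiveOn N f → BijectiveOn N g
bijectiveOn-cong {N} f≡g bij = record
  { maps = λ 0<x x<N → subst (λ y → 0 < y × y < N) (f≡g 0<x x<N) (maps 0<x x<N)
  ; injective = λ 0<x x<N 0<y y<N eq →
      injective 0<x x<N 0<y y<N (trans (f≡g 0<x x<N) (trans eq (sym (f≡g 0<y y<N)))) }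
  where open BijectiveOn bij

nth-applyUpTo : ∀ (g h : ℕ → ℕ) {n i} → i < n → nth (map g (applyUpTo h n)) i ≡ g (h i)
nth-applyUpTo g h {suc n} {zero}  _         = refl
nth-applyUpTo g h {suc n} {suc i} (s≤s i<n) = nth-applyUpTo g (h ∘ suc) i<n

asFun-table : ∀ f {N x} → 0 < x → x < N → asFun (map f (range N)) x ≡ f x
asFun-table f {suc N} {suc x} _ (s≤s x<N) =
  trans (cong (λ l → nth l x) (sym (map-∘ (upTo N)))) (nth-applyUpTo (f ∘ suc) (λ i → i) x<N)

∈-allLists : ∀ {xs} l → All (_∈ xs) l → l ∈ allLists (length l) xs
∈-allLists []      []         = Any.here refl
∈-allLists (x ∷ l) (x∈ ∷ l∈) = ∈-concatMap⁺ _ (Any.map (λ { refl → ∈-map⁺ (x ∷_) (∈-allLists l l∈) }) x∈)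

injection⇒≤length : ∀ {A : Set} {c} {xs : List A} (f : Fin c → A) → (∀ {i j} → f i ≡ f j → i ≡ j) →
  (∀ i → f i ∈ xs) → c ≤ length xs
injection⇒≤length {xs = xs} f f-inj f∈ = Finₚ.injective⇒≤ {f = Any.index ∘ f∈} λ {i} {j} eq →
  f-inj (trans (Anyₚ.lookup-index (f∈ i)) (trans (cong (lookup xs) eq) (sym (Anyₚ.lookup-index (f∈ j)))))

numExpOrth-≥ : ∀ N {c} (σ : Fin c → ℕ → ℕ) →
  (∀ i → BijectiveOn N (σ i)) → (∀ i → BijectiveOn N (λ x → modN (x ^ σ i x) N)) →
  (∀ {i j} → (∀ {x} → 0 < x → x < N → σ i x ≡ σ j x) → i ≡ j) →
  c ≤ numExpOrth N
numExpOrth-≥ N {c} σ σ-bij orth σ-inj = injection⇒≤length (λ i → table i) table-injective λ i →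
  ∈-filter⁺ (T? ∘ λ l → isExpOrth N (asFun l)) (member i)
    (Equivalence.from T-∧
      ( bijectiveOn⇒isBijOn N (asFun (table i)) (bijectiveOn-cong (λ p q → sym (asFun-table (σ i) p q)) (σ-bij i))
      , bijectiveOn⇒isBijOn N (λ x → modN (x ^ asFun (table i) x) N)
          (bijectiveOn-cong (λ {x} p q → cong (λ e → modN (x ^ e) N) (sym (asFun-table (σ i) p q))) (orth i))))
  where
  table : Fin c → List ℕ
  table i = map (σ i) (range N)
  table-injective : ∀ {i j} → table i ≡ table j → i ≡ j
  table-injective {i} {j} eq = σ-inj λ {x} p q →
    trans (sym (asFun-table (σ i) p q)) (trans (cong (λ l → asFun l x) eq) (asFun-table (σ j) p q))
  length-table : ∀ i → length (table i) ≡ N ∸ 1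
  length-table i = trans (length-map (σ i) (range N)) (trans (length-map suc (upTo (N ∸ 1))) (length-upTo (N ∸ 1)))
  member : ∀ i → table i ∈ allLists (N ∸ 1) (range N)
  member i = subst (λ n → table i ∈ allLists n (range N)) (length-table i) (∈-allLists (table i)
    (Allₚ.map⁺ (All.tabulate λ x∈ → let 0<x , x<N = ∈-range⁻ {N} x∈
                                        0<y , y<N = BijectiveOn.maps (σ-bij i) 0<x x<N in ∈-range⁺ 0<y y<N)))

-- From families to orthomorphisms

open Inverse using (to; from)

module _ (G : FinGroup) where
  open FinGroup G
  open Powers G

  ⋆-injective : ∀ {g k} → HasOrder g k → ∀ a b → a ⋆ g ≡ b ⋆ g → k ∣ ∣ a - b ∣
  ⋆-injective {g} {k} (_ , order) a b eq =
    [ up a b eq , (λ b≤a → subst (k ∣_) (∣-∣-comm b a) (up b a (sym eq) b≤a)) ]′ (≤-total a b)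
    where
    up : ∀ a b → a ⋆ g ≡ b ⋆ g → a ≤ b → k ∣ ∣ a - b ∣
    up a b eq a≤b with m≤n⇒∃[o]m+o≡n a≤b
    ... | o , refl = subst (k ∣_) (sym (∣m-m+n∣≡n a o)) (order o
      (∙-cancelˡ (a ⋆ g) _ _ (trans (sym (⋆-homo-+ g a o)) (trans (sym eq) (sym (identityʳ _))))))

-- This is why raising to a positive power never leaves the parity class, that is, the copy, of a
-- base.
mod-2-^ : ∀ x e → (x ^ suc e) mod 2 ≡ x mod 2
mod-2-^ x zero    = cong (_mod 2) (*-identityʳ x)
mod-2-^ x (suc e) = trans (mod-* x (x ^ suc e) 1) (trans (cong ((x mod 2) ·_) (mod-2-^ x e)) (idempotent (x mod 2)))
  where
  idempotent : ∀ (i : Fin 2) → i · i ≡ i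
  idempotent zero       = refl
  idempotent (suc zero) = refl

%-^ : ∀ x e d .{{_ : NonZero d}} → (x % d) ^ e % d ≡ x ^ e % d
%-^ x zero    d = refl
%-^ x (suc e) d = begin
  (x % d * (x % d) ^ e) % d       ≡⟨ %-absorbˡ x ((x % d) ^ e) d ⟩
  (x * (x % d) ^ e) % d           ≡⟨ %-absorbʳ x ((x % d) ^ e) d ⟨
  (x * ((x % d) ^ e % d)) % d     ≡⟨ cong (λ y → (x * y) % d) (%-^ x e d) ⟩
  (x * (x ^ e % d)) % d           ≡⟨ %-absorbʳ x (x ^ e) d ⟩
  (x * x ^ e) % d                 ∎
  where open ≡-Reasoning

module FromFamily (n : ℕ) (isPrime : Prime (2 + n)) (2≢p : 2 ≢ 2 + n)
  {rs : List ℕ} (primes : All Prime rs) (unique : Unique rs) (p-1≡ : suc n ≡ product rs)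
  {c : ℕ} (F : Family (_⊛_ {rs}) (Fin c)) where
  open Family F
  open Units n isPrime using (Unit; units; val)
  open Powers units using (_⋆_; ⋆-assocˡ; HasOrder)

  p M : ℕ
  p = 2 + n
  M = product rs

  g-order : ∃[ g ] HasOrder g M
  g-order = subst (λ m → ∃[ g ] HasOrder g m) p-1≡ (primitiveRoot n isPrime rs primes unique p-1≡)
  g = proj₁ g-order

  index : Residues rs → ℕ
  index x = suc (toℕ (from (crt primes unique 1) x))

  residue-index : ∀ x → residue primes (index x) ≡ x
  residue-index x = Inverse.strictlyInverseˡ (crt primes unique 1) x

  0<index : ∀ x → 0 < index x
  0<index x = z<s

  index≤M : ∀ x → index x ≤ M
  index≤M x = Finₚ.toℕ<n (from (crt primes unique 1) x)

  ⋆g-residue : ∀ a b → a ⋆ g ≡ b ⋆ g → residue primes a ≡ residue primes b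
  ⋆g-residue a b eq = residue-cong primes a b (⋆-injective units (proj₂ g-order) a b eq)

  -- The discrete exponential of the primitive root; its inverse is the discrete logarithm.
  root : Residues rs ↔ Unit
  root = injective⇒↔ (Fin↔Residues rs) (subst (λ m → Fin m ↔ Unit) p-1≡ (↔-id _)) (λ x → index x ⋆ g)
    λ {x} {y} eq → trans (sym (residue-index x)) (trans (⋆g-residue (index x) (index y) eq) (residue-index y))

  ⋆-root : ∀ x e → e ⋆ to root x ≡ (index x * e) ⋆ g
  ⋆-root x e = trans (⋆-assocˡ g e (index x)) (cong (_⋆ g) (*-comm e (index x)))

  -- Raising to the power `e` multiplies the logarithm by `e`, so equal powers in the unit group
  -- become equal products in ℤ/M.
  root-⊛ : ∀ x y e e′ → e ⋆ to root x ≡ e′ ⋆ to root y → x ⊛ residue primes e ≡ y ⊛ residue primes e′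
  root-⊛ x y e e′ eq = begin
    x ⊛ residue primes e                         ≡⟨ cong (_⊛ residue primes e) (residue-index x) ⟨
    residue primes (index x) ⊛ residue primes e  ≡⟨ residue-* primes (index x) e ⟨
    residue primes (index x * e)                 ≡⟨ ⋆g-residue (index x * e) (index y * e′) (trans (sym (⋆-root x e)) (trans eq (⋆-root y e′))) ⟩
    residue primes (index y * e′)                ≡⟨ residue-* primes (index y) e′ ⟩
    residue primes (index y) ⊛ residue primes e′ ≡⟨ cong (_⊛ residue primes e′) (residue-index y) ⟩
    y ⊛ residue primes e′                        ∎
    where open ≡-Reasoning

  -- Copy `false` occupies 1, ..., M and copy `true` occupies M + 1, ..., 2M, so each residue class
  -- modulo M is used twice.
  exponent : Bool × Residues rs → ℕ
  exponent (false , x) = index x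
  exponent (true  , x) = M + index x

  residue-exponent : ∀ κx → residue primes (exponent κx) ≡ proj₂ κx
  residue-exponent (false , x) = residue-index x
  residue-exponent (true  , x) = trans (residue-cong primes (M + index x) (index x)
    (subst (M ∣_) (sym (trans (∣-∣-comm (M + index x) (index x)) (trans (cong (∣ index x -_∣) (+-comm M (index x))) (∣m-m+n∣≡n (index x) M)))) ∣-refl))
    (residue-index x)

  0<exponent : ∀ κx → 0 < exponent κx
  0<exponent (false , x) = z<s
  0<exponent (true  , x) = <-≤-trans (0<index x) (m≤n+m (index x) M)

  exponent≤ : ∀ κx → exponent κx ≤ M + M
  exponent≤ (false , x) = ≤-trans (index≤M x) (m≤m+n M M)
  exponent≤ (true  , x) = +-monoʳ-≤ M (index≤M x)

  exponent-injective : ∀ κx μy → exponent κx ≡ exponent μy → κx ≡ μy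
  exponent-injective κx μy eq = cong₂ _,_ (copy κx μy eq)
    (trans (sym (residue-exponent κx)) (trans (cong (residue primes) eq) (residue-exponent μy)))
    where
    separated : ∀ x y → index x ≢ M + index y
    separated x y eq = <⇒≱ (m<m+n M (0<index y)) (≤-trans (≤-reflexive (sym eq)) (index≤M x))
    copy : ∀ κx μy → exponent κx ≡ exponent μy → proj₁ κx ≡ proj₁ μy
    copy (false , x) (false , y) _  = refl
    copy (false , x) (true  , y) eq = contradiction eq (separated x y)
    copy (true  , x) (false , y) eq = contradiction (sym eq) (separated y x)
    copy (true  , x) (true  , y) _  = refl

  point : Fin 2 → Unit → Bool × Residues rs
  point κ u = to Finₚ.2↔Bool κ , from root u

  -- The one nonzero x that is 0 modulo p, namely p itself, receives the exponent left over.
  label : Fin c → Fin 2 → Fin p → ℕ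
  label i κ zero    = suc (M + M)
  label i κ (suc u) = exponent (s i (point κ u))

  0<label : ∀ i κ a → 0 < label i κ a
  0<label i κ zero    = z<s
  0<label i κ (suc u) = 0<exponent (s i (point κ u))

  label≤ : ∀ i κ a → label i κ a ≤ suc (M + M)
  label≤ i κ zero    = ≤-refl
  label≤ i κ (suc u) = m≤n⇒m≤1+n (exponent≤ (s i (point κ u)))

  -- In the first alternative both bases vanish modulo `p`; their parity is settled later by
  -- `nonzero-mod-2`, as `p` is the only such base in range.
  label-injective : ∀ i κ μ a b → label i κ a ≡ label i μ b → (a ≡ zero × b ≡ zero) ⊎ (κ ≡ μ × a ≡ b)
  label-injective i κ μ zero    zero    eq = inj₁ (refl , refl)
  label-injective i κ μ zero    (suc v) eq = contradiction (≤-trans (≤-reflexive eq) (exponent≤ (s i (point μ v)))) 1+n≰n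
  label-injective i κ μ (suc u) zero    eq = contradiction (≤-trans (≤-reflexive (sym eq)) (exponent≤ (s i (point κ u)))) 1+n≰n
  label-injective i κ μ (suc u) (suc v) eq = inj₂ (to-injective Finₚ.2↔Bool (,-injectiveˡ same) , cong suc (to-injective (↔-sym root) (,-injectiveʳ same)))
    where
    same : point κ u ≡ point μ v
    same = injective i (exponent-injective (s i (point κ u)) (s i (point μ v)) eq)

  power : Fin p → ℕ → Fin p
  power zero    e = zero
  power (suc u) e = suc (e ⋆ u)

  power-label-injective : ∀ i κ a b → power a (label i κ a) ≡ power b (label i κ b) → a ≡ b
  power-label-injective i κ zero    zero    eq = refl
  power-label-injective i κ zero    (suc v) ()
  power-label-injective i κ (suc u) zero    ()
  power-label-injective i κ (suc u) (suc v) eq = cong suc (to-injective (↔-sym root) (∙-injective i (to Finₚ.2↔Bool κ) products))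
    where
    e = label i κ (suc u)
    e′ = label i κ (suc v)
    x = from root u
    y = from root v
    powers : e ⋆ to root x ≡ e′ ⋆ to root y
    powers = trans (cong (e ⋆_) (Inverse.strictlyInverseˡ root u))
      (trans (Finₚ.suc-injective eq) (cong (e′ ⋆_) (sym (Inverse.strictlyInverseˡ root v))))
    products : x ⊛ proj₂ (s i (point κ u)) ≡ y ⊛ proj₂ (s i (point κ v))
    products = trans (cong (x ⊛_) (sym (residue-exponent (s i (point κ u)))))
      (trans (root-⊛ x y e e′ powers) (cong (y ⊛_) (residue-exponent (s i (point κ v)))))

  -- For `e` = 0 and `x` divisible by `p` this fails, since 0^0 is 1; hence the insistence on
  -- positive labels.
  mod-^ : ∀ x e → 0 < e → (x ^ e) mod p ≡ power (x mod p) e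
  mod-^ x (suc e) _ = Finₚ.toℕ-injective (trans (toℕ-mod (x ^ suc e) (suc n)) (go (x mod p) (toℕ-mod x (suc n))))
    where
    open ≡-Reasoning
    go : ∀ (a : Fin p) → toℕ a ≡ x % p → x ^ suc e % p ≡ toℕ (power a (suc e))
    go zero    eq = begin
      x ^ suc e % p         ≡⟨ %-absorbˡ x (x ^ e) p ⟨
      (x % p * x ^ e) % p   ≡⟨ cong (λ y → (y * x ^ e) % p) eq ⟨
      0                     ∎
    go (suc u) eq = begin
      x ^ suc e % p         ≡⟨ %-^ x (suc e) p ⟨
      (x % p) ^ suc e % p   ≡⟨ cong (λ y → y ^ suc e % p) eq ⟨
      val u ^ suc e % p     ≡⟨ val-⋆ n isPrime (suc e) u ⟨
      val (suc e ⋆ u)       ∎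

  2,p : List ℕ
  2,p = 2 ∷ p ∷ []

  2,p-prime : All Prime 2,p
  2,p-prime = prime[2] ∷ isPrime ∷ []

  2,p-unique : Unique 2,p
  2,p-unique = (2≢p ∷ []) ∷ [] ∷ []

  code : ℕ → Residues 2,p
  code = residue 2,p-prime

  N : ℕ
  N = 2 * p

  ∏≡N : product 2,p ≡ N
  ∏≡N = cong (2 *_) (*-identityʳ p)

  code-injective : ∀ {x y} → x < N → y < N → code x ≡ code y → x ≡ y
  code-injective {x} {y} x<N y<N eq = ∣m-n∣≡0⇒m≡n (small∣⇒≡0
    (subst (_∣ ∣ x - y ∣) ∏≡N (residue-injective 2,p-prime 2,p-unique {x} {y} eq))
    (≤-<-trans (∣m-n∣≤m⊔n x y) (⊔-lub x<N y<N)))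

  code-surjective : ∀ r → ∃[ x ] x < N × code x ≡ r
  code-surjective r = toℕ j , subst (toℕ j <_) ∏≡N (Finₚ.toℕ<n j) , Inverse.strictlyInverseˡ (crt 2,p-prime 2,p-unique 0) r
    where j = from (crt 2,p-prime 2,p-unique 0) r

  code-% : ∀ x → code (x % N) ≡ code x
  code-% x = residue-cong 2,p-prime (x % N) x (subst (_∣ ∣ x % N - x ∣) (sym ∏≡N) (%≡⇒∣∣-∣ (x % N) x N (m%n%n≡m%n x N)))

  zero-code : ∀ {x} → x < N → x mod 2 ≡ zero → x mod p ≡ zero → x ≡ 0
  zero-code x<N eq₂ eqₚ = code-injective x<N z<s (cong₂ (λ a b → a , b , tt) eq₂ eqₚ)

  σ : Fin c → ℕ → ℕ
  σ i x = label i (x mod 2) (x mod p)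

  0<σ : ∀ i x → 0 < σ i x
  0<σ i x = 0<label i (x mod 2) (x mod p)

  2M+1<N : suc (M + M) < N
  2M+1<N = ≤-reflexive (begin
    2 + (M + M)             ≡⟨ cong (λ m → 2 + (m + m)) p-1≡ ⟨
    2 + (suc n + suc n)     ≡⟨ cong suc (+-suc (suc n) (suc n)) ⟨
    (2 + n) + (2 + n)       ≡⟨ cong (_+_ p) (+-identityʳ p) ⟨
    N                       ∎)
    where open ≡-Reasoning

  nonzero-mod-2 : ∀ {x} → 0 < x → x < N → x mod p ≡ zero → x mod 2 ≡ suc zero
  nonzero-mod-2 {x} 0<x x<N eqₚ = go (x mod 2) refl
    where
    go : ∀ (κ : Fin 2) → x mod 2 ≡ κ → κ ≡ suc zero
    go zero       eq₂ = contradiction (zero-code x<N eq₂ eqₚ) (m<n⇒n≢0 0<x)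
    go (suc zero) _   = refl

  σ-bijective : ∀ i → BijectiveOn N (σ i)
  σ-bijective i = record
    { maps = λ {x} _ _ → 0<σ i x , ≤-<-trans (label≤ i (x mod 2) (x mod p)) 2M+1<N
    ; injective = inj }
    where
    inj : ∀ {x y} → 0 < x → x < N → 0 < y → y < N → σ i x ≡ σ i y → x ≡ y
    inj {x} {y} 0<x x<N 0<y y<N eq with label-injective i (x mod 2) (y mod 2) (x mod p) (y mod p) eq
    ... | inj₁ (x≡0 , y≡0) = code-injective x<N y<N (cong₂ (λ a b → a , b , tt)
            (trans (nonzero-mod-2 0<x x<N x≡0) (sym (nonzero-mod-2 0<y y<N y≡0))) (trans x≡0 (sym y≡0)))
    ... | inj₂ (eq₂ , eqₚ) = code-injective x<N y<N (cong₂ (λ a b → a , b , tt) eq₂ eqₚ)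

  θ : Fin c → ℕ → ℕ
  θ i x = modN (x ^ σ i x) N

  code-θ : ∀ i x → code (θ i x) ≡ (x mod 2 , power (x mod p) (σ i x) , tt)
  code-θ i x = trans (code-% (x ^ σ i x)) (cong₂ (λ a b → a , b , tt)
    (parity (σ i x) (0<σ i x)) (mod-^ x (σ i x) (0<σ i x)))
    where
    parity : ∀ e → 0 < e → (x ^ e) mod 2 ≡ x mod 2
    parity (suc e) _ = mod-2-^ x e

  θ<N : ∀ i x → θ i x < N
  θ<N i x = m%n<n (x ^ σ i x) N

  -- The range includes 0, which `θ` fixes, so injectivity also shows that `θ` sends nonzero bases
  -- to nonzero residues.
  θ-injective : ∀ i {x y} → x < N → y < N → code (θ i x) ≡ code (θ i y) → x ≡ y
  θ-injective i {x} {y} x<N y<N eq = code-injective x<N y<N (cong₂ (λ a b → a , b , tt) eq₂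
    (power-label-injective i (x mod 2) (x mod p) (y mod p)
      (trans (cong (proj₁ ∘ proj₂) codes) (cong (λ κ → power (y mod p) (label i κ (y mod p))) (sym eq₂)))))
    where
    codes = trans (sym (code-θ i x)) (trans eq (code-θ i y))
    eq₂ : x mod 2 ≡ y mod 2
    eq₂ = cong proj₁ codes

  θ-bijective : ∀ i → BijectiveOn N (θ i)
  θ-bijective i = record
    { maps = λ {x} 0<x x<N → n≢0⇒n>0 (λ θ≡0 → contradiction
        (θ-injective i x<N z<s (trans (cong code θ≡0) (sym (code-θ i 0)))) (m<n⇒n≢0 0<x)) , θ<N i x
    ; injective = λ {x} {y} _ x<N _ y<N eq → θ-injective i x<N y<N (cong code eq) }

  σ-faithful : ∀ {i j} → (∀ {x} → 0 < x → x < N → σ i x ≡ σ j x) → i ≡ j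
  σ-faithful {i} {j} same = faithful λ (κ , x) →
    subst₂ (λ κ′ y → s i (κ′ , y) ≡ s j (κ′ , y)) (Inverse.strictlyInverseˡ Finₚ.2↔Bool κ) (Inverse.strictlyInverseʳ root x)
      (at (from Finₚ.2↔Bool κ) (to root x) (code-surjective (from Finₚ.2↔Bool κ , suc (to root x) , tt)))
    where
    at : ∀ κ u → ∃[ x ] x < N × code x ≡ (κ , suc u , tt) → s i (point κ u) ≡ s j (point κ u)
    at κ u (x , x<N , eq) = exponent-injective _ _ (subst₂ (λ κ a → label i κ a ≡ label j κ a)
      (cong proj₁ eq) (cong (proj₁ ∘ proj₂) eq) (same (n≢0⇒n>0 x≢0) x<N))
      where
      x≢0 : x ≢ 0
      x≢0 refl with cong (proj₁ ∘ proj₂) eq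
      ... | ()

  count : c ≤ numExpOrth N
  count = numExpOrth-≥ N σ σ-bijective θ-bijective σ-faithful

-- The bound

totient≤product : ∀ qs → totient qs ≤ product qs
totient≤product []       = ≤-refl
totient≤product (q ∷ qs) = *-mono-≤ (pred[n]≤n {q}) (totient≤product qs)

factor : ℕ → ℕ
factor k = (k + 2) ! * 3 ^ (k + 1)

factor-suc : ∀ k → factor (suc k) ≡ factor k * (3 * (k + 3))
factor-suc k = ring k ((k + 2) !) (3 ^ (k + 1))
  where
  ring : ∀ k f t → (1 + (k + 2)) * f * (3 * t) ≡ f * t * (3 * (k + 3))
  ring = solve-∀

n≤n! : ∀ n → n ≤ n !
n≤n! zero    = z≤n
n≤n! (suc n) = m≤m*n (suc n) (n !) {{n !≢0}}

3[k+3]≤4*factor : ∀ k → 3 * (k + 3) ≤ 4 * factor k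
3[k+3]≤4*factor k = begin
  3 * (k + 3)             ≤⟨ m≤m+n (3 * (k + 3)) (9 * k + 15) ⟩
  3 * (k + 3) + (9 * k + 15) ≡⟨ ring k ⟩
  4 * ((k + 2) * 3)       ≤⟨ *-monoʳ-≤ 4 (*-mono-≤ (n≤n! (k + 2)) (^-monoʳ-≤ 3 (m≤n+m 1 k))) ⟩
  4 * factor k            ∎
  where
  open ≤-Reasoning
  ring : ∀ k → 3 * (k + 3) + (9 * k + 15) ≡ 4 * ((k + 2) * 3)
  ring = solve-∀

square-bound : ∀ f r X → r ≤ 4 * f → 16 * f ^ 2 ≤ X → 16 * (f * r) ^ 2 ≤ X * X
square-bound f r X r≤ bound = begin
  16 * (f * r) ^ 2            ≡⟨ ring₁ f r ⟩
  16 * f ^ 2 * (r * r)        ≤⟨ *-mono-≤ bound (*-mono-≤ r≤ r≤) ⟩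
  X * (4 * f * (4 * f))       ≡⟨ cong (X *_) (ring₂ f) ⟩
  X * (16 * f ^ 2)            ≤⟨ *-monoʳ-≤ X bound ⟩
  X * X                       ∎
  where
  open ≤-Reasoning
  ring₁ : ∀ f r → 16 * (f * r * (f * r * 1)) ≡ 16 * (f * (f * 1)) * (r * r)
  ring₁ = solve-∀
  ring₂ : ∀ f → 4 * f * (4 * f) ≡ 16 * (f * (f * 1))
  ring₂ = solve-∀

-- For one odd prime this is 16 * 54² ≤ 384². Each further prime multiplies the left side by (3(k +
-- 3))², at most 16 times the square of the current factor, while the right side is squared.
factor-bound : ∀ k D → 3 ≤ D → 16 * factor (suc k) ^ 2 ≤ (128 * D) ^ (2 ^ suc k)
factor-bound zero    D 3≤D = begin
  16 * factor 1 ^ 2 ≤⟨ toWitness {a? = 16 * factor 1 ^ 2 ≤? (128 * 3) ^ 2} _ ⟩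
  (128 * 3) ^ 2     ≤⟨ ^-monoˡ-≤ 2 (*-monoʳ-≤ 128 3≤D) ⟩
  (128 * D) ^ 2     ∎
  where open ≤-Reasoning
factor-bound (suc k) D 3≤D = subst₂ (λ x y → 16 * x ^ 2 ≤ y) (sym (factor-suc (suc k)))
  (sym (^-double (128 * D) (2 ^ suc k)))
  (square-bound (factor (suc k)) (3 * (suc k + 3)) _ (3[k+3]≤4*factor (suc k)) (factor-bound k D 3≤D))

128^E : ∀ D E → (128 * D) ^ E * (D ^ E * D ^ E) ≡ (4 * D) ^ (3 * E) * 2 ^ E
128^E D E = begin
  (128 * D) ^ E * (D ^ E * D ^ E)       ≡⟨ cong ((128 * D) ^ E *_) (^-distribʳ-* E D D) ⟨
  (128 * D) ^ E * (D * D) ^ E           ≡⟨ ^-distribʳ-* E (128 * D) (D * D) ⟨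
  (128 * D * (D * D)) ^ E               ≡⟨ cong (_^ E) (ring D) ⟩
  ((4 * D) ^ 3 * 2) ^ E                 ≡⟨ ^-distribʳ-* E ((4 * D) ^ 3) 2 ⟩
  ((4 * D) ^ 3) ^ E * 2 ^ E             ≡⟨ cong (_* 2 ^ E) (^-*-assoc (4 * D) 3 E) ⟩
  (4 * D) ^ (3 * E) * 2 ^ E             ∎
  where
  open ≡-Reasoning
  ring : ∀ D → 128 * D * (D * D) ≡ 4 * D * (4 * D * (4 * D * 1)) * 2
  ring = solve-∀

-- The two hypotheses multiply to 16^(2D) ≤ 16 (cd)² Φ^(2E). The bound on `K` uses the constant 128
-- because 128 D * D² = 2 (4D)³, which turns D^(2E) into the power of n - 2 = 4D in the theorem.
finalBound : ∀ K D Φ E c d N → 16 ^ D ≤ 4 * c ^ 2 * Φ ^ E → 16 ^ D ≤ 4 * d ^ 2 * Φ ^ E →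
  c * d ≤ N → Φ ≤ D → 16 * K ^ 2 ≤ (128 * D) ^ E →
  K ^ 2 * (16 * 16 ^ (2 * D)) ≤ 16 * N ^ 2 * (4 * D) ^ (3 * E) * 2 ^ E
finalBound K D Φ E c d N bound-c bound-d cd≤N Φ≤D K≤ = begin
  K ^ 2 * (16 * 16 ^ (2 * D))
    ≡⟨ cong (λ x → K ^ 2 * (16 * x)) (^-double 16 D) ⟩
  K ^ 2 * (16 * (16 ^ D * 16 ^ D))
    ≤⟨ *-monoʳ-≤ (K ^ 2) (*-monoʳ-≤ 16 (*-mono-≤ bound-c bound-d)) ⟩
  K ^ 2 * (16 * (4 * c ^ 2 * Φ ^ E * (4 * d ^ 2 * Φ ^ E)))
    ≡⟨ ring₁ (K ^ 2) (c ^ 2) (d ^ 2) (Φ ^ E) ⟩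
  16 * (c ^ 2 * d ^ 2) * (16 * K ^ 2 * (Φ ^ E * Φ ^ E))
    ≡⟨ cong (λ x → 16 * x * (16 * K ^ 2 * (Φ ^ E * Φ ^ E))) (^-distribʳ-* 2 c d) ⟨
  16 * (c * d) ^ 2 * (16 * K ^ 2 * (Φ ^ E * Φ ^ E))
    ≤⟨ *-mono-≤ (*-monoʳ-≤ 16 (^-monoˡ-≤ 2 cd≤N)) (*-mono-≤ K≤ (*-mono-≤ Φ^E≤D^E Φ^E≤D^E)) ⟩
  16 * N ^ 2 * ((128 * D) ^ E * (D ^ E * D ^ E))
    ≡⟨ cong (16 * N ^ 2 *_) (128^E D E) ⟩
  16 * N ^ 2 * ((4 * D) ^ (3 * E) * 2 ^ E)
    ≡⟨ *-assoc (16 * N ^ 2) ((4 * D) ^ (3 * E)) (2 ^ E) ⟨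
  16 * N ^ 2 * (4 * D) ^ (3 * E) * 2 ^ E ∎
  where
  open ≤-Reasoning
  Φ^E≤D^E = ^-monoˡ-≤ E Φ≤D
  ring₁ : ∀ K c d f → K * (16 * (4 * c * f * (4 * d * f))) ≡ 16 * (c * d) * (16 * K * (f * f))
  ring₁ = solve-∀

trivialGroup : FinGroup
trivialGroup = Units.units 0 prime[2]

-- `c` and `d` count the members over the even and the odd residues modulo 2. The units of 𝔽₂ are
-- trivial, so both parts fall under `trivialFamily`.
residueFamily : ∀ qs → All OddPrime qs → ∃[ c ] ∃[ d ] Family (_⊛_ {2 ∷ qs}) (Fin (c * d)) ×
  16 ^ product qs ≤ 4 * c ^ 2 * totient qs ^ (2 ^ length qs) ×
  16 ^ product qs ≤ 4 * d ^ 2 * totient qs ^ (2 ^ length qs)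
residueFamily qs odd = proj₁ F₁ , proj₁ F₂ ,
  transportFamily (mk↔ₛ′ (zero ,_) proj₂ (λ { (zero , _) → refl }) (λ _ → refl)) (λ _ _ → refl)
    (combineFamilies trivialGroup 0 prime[2] qs (proj₁ (proj₂ F₁)) (proj₁ (proj₂ F₂))) ,
  proj₂ (proj₂ F₁) , proj₂ (proj₂ F₂)
  where
  F₁ = trivialFamily qs odd trivialGroup refl
  F₂ = trivialFamily qs odd (trivialGroup ⊗ trivialGroup) refl

3≤product : ∀ q qs → OddPrime q → product (q ∷ qs) ≢ 0 → 3 ≤ product (q ∷ qs)
3≤product 0 qs (q , _) _ = contradiction q ¬prime[0]
3≤product 1 qs (q , _) _ = contradiction q ¬prime[1]
3≤product 2 qs (_ , odd) _ = contradiction ∣-refl odd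
3≤product q@(suc (suc (suc _))) qs _ nz = ≤-trans (s≤s (s≤s (s≤s z≤n)))
  (m≤m*n q (product qs) {{≢-nonZero λ eq → nz (trans (cong (q *_) eq) (*-zeroʳ q))}})

-- Checked by running through all 5^5 value lists.
numExpOrth-6 : numExpOrth 6 ≡ 36
numExpOrth-6 = refl

-- Squaring and clearing denominators turns the exponent 2^(k-1), which is 1/2 for k = 0, into the
-- natural number 2^k.
numExpOrth-bound : ∀ n qs → Prime (2 + n) → ¬ (2 ∣ 2 + n) → Unique qs → All OddPrime qs →
  suc n ≡ 2 * product qs →
  factor (length qs) ^ 2 * 2 ^ (2 * (2 * (2 + n)))
    ≤ 16 * numExpOrth (2 * (2 + n)) ^ 2 * (2 * (2 + n) ∸ 2) ^ (3 * 2 ^ length qs) * 2 ^ (2 ^ length qs)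
-- For p = 3 the families above have only 4 members, fewer than the 9 needed.
numExpOrth-bound n [] isPrime odd-p unique odd refl =
  subst (λ N → 147456 ≤ 16 * N ^ 2 * 4 ^ 3 * 2) (sym numExpOrth-6)
    (toWitness {a? = 147456 ≤? 16 * 36 ^ 2 * 4 ^ 3 * 2} _)
numExpOrth-bound n qs@(q ∷ qs′) isPrime odd-p unique odd@(q-odd ∷ _) p-1≡ =
  subst₂ (λ x y → factor (length qs) ^ 2 * x ≤ 16 * numExpOrth (2 * (2 + n)) ^ 2 * y ^ (3 * 2 ^ length qs) * 2 ^ (2 ^ length qs))
    powers base (finalBound (factor (length qs)) D (totient qs) (2 ^ length qs) c d _
      bound-c bound-d (FromFamily.count n isPrime 2≢p rs-prime rs-unique p-1≡ F)
      (totient≤product qs) (factor-bound (length qs′) D (3≤product q qs′ q-odd D≢0)))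
  where
  D = product qs
  family = residueFamily qs odd
  c = proj₁ family
  d = proj₁ (proj₂ family)
  F = proj₁ (proj₂ (proj₂ family))
  bound-c = proj₁ (proj₂ (proj₂ (proj₂ family)))
  bound-d = proj₂ (proj₂ (proj₂ (proj₂ family)))

  2≢p : 2 ≢ 2 + n
  2≢p eq = odd-p (subst (2 ∣_) eq ∣-refl)
  rs-prime : All Prime (2 ∷ qs)
  rs-prime = prime[2] ∷ All.map proj₁ odd
  rs-unique : Unique (2 ∷ qs)
  rs-unique = All.map (λ (_ , 2∤q) eq → 2∤q (subst (2 ∣_) eq ∣-refl)) odd ∷ unique
  D≢0 : D ≢ 0
  D≢0 eq = contradiction (trans p-1≡ (cong (2 *_) eq)) λ ()
  base : 4 * D ≡ 2 * (2 + n) ∸ 2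
  base = begin
    4 * D             ≡⟨ ring D ⟩
    2 * (2 * D)       ≡⟨ cong (2 *_) p-1≡ ⟨
    2 * suc n         ≡⟨ *-distribˡ-∸ 2 (2 + n) 1 ⟩
    2 * (2 + n) ∸ 2   ∎
    where
    open ≡-Reasoning
    ring : ∀ D → 4 * D ≡ 2 * (2 * D)
    ring = solve-∀
  powers : 16 * 16 ^ (2 * D) ≡ 2 ^ (2 * (2 * (2 + n)))
  powers = begin
    16 ^ suc (2 * D)          ≡⟨ cong (λ m → 16 ^ suc m) p-1≡ ⟨
    16 ^ (2 + n)              ≡⟨ ^-*-assoc 2 4 (2 + n) ⟩
    2 ^ (4 * (2 + n))         ≡⟨ cong (2 ^_) (ring (2 + n)) ⟩
    2 ^ (2 * (2 * (2 + n)))   ∎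
    where
    open ≡-Reasoning
    ring : ∀ p → 4 * p ≡ 2 * (2 * p)
    ring = solve-∀

theorem1p5 : (p : ℕ) (qs : List ℕ) → Prime p → ¬ (2 ∣ p) →
    Unique qs → All (λ q → Prime q × ¬ (2 ∣ q)) qs →
    p ∸ 1 ≡ 2 * product qs →
    ((length qs + 2) ! * 3 ^ (length qs + 1)) ^ 2 * 2 ^ (2 * (2 * p))
    ≤ 16 * numExpOrth (2 * p) ^ 2 * (2 * p ∸ 2) ^ (3 * 2 ^ length qs) * 2 ^ (2 ^ length qs)
theorem1p5 0             qs p-prime = contradiction p-prime ¬prime[0]
theorem1p5 1             qs p-prime = contradiction p-prime ¬prime[1]
theorem1p5 (suc (suc n)) qs p-prime = numExpOrth-bound n qs p-prime
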